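{- For every connected graph $\hat G$ on $n$ vertices with maximum degree $\Delta$, $$\mathrm{OPT}(\hat G)\le n^{1+O\left(\sqrt{(\log\log n+\log\Delta)/\log n}\right)},$$ where the constant in the $O(\cdot)$ is absolute.
   Context: Let $\hat G=(V,\hat E)$ be a connected unweighted graph with shortest-path metric $\hat\delta$. Let $\widehat{\mathit{NE}}$ be the set of unordered pairs $\{a,b\}$ of distinct vertices with $\{a,b\}\notin\hat E$. For $(u,v)\in V^2$, let $S_{u,v}$ be the set of $\{a,b\}\in\widehat{\mathit{NE}}$ such that $\hat\delta(u,a)+\hat\delta(b,v)+1<\hat\delta(u,v)$ or $\hat\delta(u,b)+\hat\delta(a,v)+1<\hat\delta(u,v)$. Define $\mathrm{OPT}(\hat G)$ as the minimum cardinality of a set $T\subseteq V\times V$ such that $\bigcup_{(u,v)\in T}S_{u,v}=\widehat{\mathit{NE}}$. (Equivalently, $\mathrm{OPT}(\hat G)$ is the minimum number of distance queries that certify, for an unknown graph $G\supseteq\hat G$ on $V$, that every non-edge of $\hat G$ is a non-edge of $G$.) -}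

module Defs where

open import Algebra.Definitions.RawSemiring using () renaming (_^_ to pow)
open import Data.Empty using (⊥-elim)
open import Data.Fin using (Fin; combine)
open import Data.Fin.Properties using (any?; all?; _≟_)
open import Data.Fin.Subset using (Subset; _∈_; ∣_∣; ⊤)
open import Data.Fin.Subset.Properties using (_∈?_; ∈⊤; anySubset?)
open import Data.Integer.Base using (ℤ; +_; -[1+_])
open import Data.List.Base using (allFin; filter; length; map)
open import Data.List.Extrema.Nat using (max)
open import Data.Nat as ℕ using (ℕ; zero; suc; z≤n; s≤s)
import Data.Nat.Properties as ℕ
open import Data.Product.Base using (∃; ∃₂; _×_; _,_; proj₁; proj₂)
open import Data.Rational.Unnormalised.Base as ℚ using (ℚᵘ; 0ℚᵘ; ½; ↥_; ↧ₙ_)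
open import Data.Sum.Base using (_⊎_; inj₁; inj₂)
open import Function.Base using (_∘_)
open import Function.Bundles using (_⇔_; mk⇔; Equivalence)
open import Relation.Binary.PropositionalEquality using (_≡_; _≢_; refl)
open import Relation.Nullary using (¬_; Dec; yes; no; ¬?; _×-dec_; _⊎-dec_; _→-dec_; map′)
open import Relation.Unary using (Decidable)

------------------------------------------------------------------------
-- Real arithmetic

-- A real number is given by the rationals strictly below it and those
-- strictly above it.  The record does not carry the Dedekind axioms; each
-- operation yields the exact cut of its value when applied to Dedekind
-- reals in its stated domain, and is unspecified outside that domain.

record ℝ : Set₁ where
  field
    lower : ℚᵘ → Set
    upper : ℚᵘ → Set

open ℝ public

infix  4 _≤_
infixl 6 _+_
infixl 7 _*_ _/_
infixr 8 _^_

_≤_ : ℝ → ℝ → Set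
x ≤ y = ∀ q → upper y q → upper x q

fromℕ : ℕ → ℝ
lower (fromℕ n) q = q ℚ.< (+ n ℚ./ 1)
upper (fromℕ n) q = (+ n ℚ./ 1) ℚ.< q

_+_ : ℝ → ℝ → ℝ
lower (x + y) q = ∃₂ λ a b → lower x a × lower y b × q ℚ.≤ a ℚ.+ b
upper (x + y) q = ∃₂ λ a b → upper x a × upper y b × a ℚ.+ b ℚ.≤ q

-- Domain: x ≥ 0, y ≥ 0.
_*_ : ℝ → ℝ → ℝ
lower (x * y) q =
  q ℚ.< 0ℚᵘ ⊎
  ∃₂ λ a b → 0ℚᵘ ℚ.≤ a × lower x a × 0ℚᵘ ℚ.≤ b × lower y b × q ℚ.≤ a ℚ.* b
upper (x * y) q =
  ∃₂ λ a b → 0ℚᵘ ℚ.< a × upper x a × 0ℚᵘ ℚ.< b × upper y b × a ℚ.* b ℚ.≤ q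

-- Domain: x ≥ 0, y > 0.
_/_ : ℝ → ℝ → ℝ
lower (x / y) q =
  q ℚ.< 0ℚᵘ ⊎
  ∃₂ λ a b → 0ℚᵘ ℚ.≤ a × lower x a × 0ℚᵘ ℚ.< b × upper y b × q ℚ.* b ℚ.≤ a
upper (x / y) q =
  ∃₂ λ a b → 0ℚᵘ ℚ.< a × upper x a × 0ℚᵘ ℚ.< b × lower y b × a ℚ.≤ q ℚ.* b

-- Domain: x ≥ 0.
√ : ℝ → ℝ
lower (√ x) q = q ℚ.< 0ℚᵘ ⊎ lower x (q ℚ.* q)
upper (√ x) q = 0ℚᵘ ℚ.< q × upper x (q ℚ.* q)

infixr 8 _^ℚ_

_^ℚ_ : ℚᵘ → ℕ → ℚᵘ
_^ℚ_ = pow ℚ.+-*-rawSemiring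

2^ℤ : ℤ → ℚᵘ
2^ℤ (+ k)    = (+ 2 ℚ./ 1) ^ℚ k
2^ℤ -[1+ k ] = ½ ^ℚ suc k

-- The comparisons 2^q ≤ r and r ≤ 2^q for rational q = m/d and r: for
-- positive r, raise both sides to the power d.

2^_≤ℚ_ : ℚᵘ → ℚᵘ → Set
2^ q ≤ℚ r = 0ℚᵘ ℚ.< r × 2^ℤ (↥ q) ℚ.≤ r ^ℚ (↧ₙ q)

_≤ℚ2^_ : ℚᵘ → ℚᵘ → Set
r ≤ℚ2^ q = r ℚ.≤ 0ℚᵘ ⊎ r ^ℚ (↧ₙ q) ℚ.≤ 2^ℤ (↥ q)

-- Every member of upper (exp₂ x) is positive for arbitrary x, so 0 ≤ exp₂ x
-- holds even where x is unspecified, for instance x = 0/0.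
exp₂ : ℝ → ℝ
lower (exp₂ x) q = ∃ λ a → lower x a × q ≤ℚ2^ a
upper (exp₂ x) q = ∃ λ a → upper x a × 2^ a ≤ℚ q

-- Base-2 logarithm.  Domain: x > 0.
log : ℝ → ℝ
lower (log x) q = ∃ λ a → lower x a × 2^ q ≤ℚ a
upper (log x) q = ∃ λ a → upper x a × a ≤ℚ2^ q

-- Domain: x ≥ 1, y ≥ 0.
_^_ : ℝ → ℝ → ℝ
x ^ y = exp₂ (y * log x)

------------------------------------------------------------------------
-- Minima of inhabited decidable predicates on ℕ

IsMinimum : (ℕ → Set) → ℕ → Set
IsMinimum P m = P m × (∀ k → P k → m ℕ.≤ k)

search : {P : ℕ → Set} → Decidable P → ∀ m → P m → ∃ (IsMinimum P)
search P? zero    p = zero , p , λ _ _ → z≤n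
search P? (suc m) p with P? zero
... | yes p₀ = zero , p₀ , λ _ _ → z≤n
... | no ¬p₀ with search (P? ∘ suc) m p
...   | k , pk , k≤ = suc k , pk , λ where
          zero    p₀ → ⊥-elim (¬p₀ p₀)
          (suc j) pj → s≤s (k≤ j pj)

minimum : {P : ℕ → Set} → Decidable P → ∃ P → ∃ (IsMinimum P)
minimum P? (m , p) = search P? m p

------------------------------------------------------------------------
-- Graphs

record Graph (n : ℕ) : Set₁ where
  field
    _~_    : Fin n → Fin n → Set
    _~?_   : ∀ u v → Dec (u ~ v)
    ~-sym  : ∀ {u v} → u ~ v → v ~ u
    ~-irr  : ∀ {u} → ¬ (u ~ u)

module _ {n : ℕ} (G : Graph n) where
  open Graph G

  degree : Fin n → ℕ
  degree v = length (filter (v ~?_) (allFin n))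

  maxDegree : ℕ
  maxDegree = max 0 (map degree (allFin n))

  infixr 5 _∷_

  data Walk : Fin n → Fin n → ℕ → Set where
    []  : ∀ {u} → Walk u u 0
    _∷_ : ∀ {u v w k} → u ~ v → Walk v w k → Walk u w (suc k)

  Connected : Set
  Connected = ∀ u v → ∃ (Walk u v)

  walk? : ∀ u v → Decidable (Walk u v)
  walk? u v zero    = map′ (λ { refl → [] }) (λ { [] → refl }) (u ≟ v)
  walk? u v (suc k) =
    map′ (λ { (w , e , p) → e ∷ p }) (λ { (e ∷ p) → _ , e , p })
         (any? λ w → (u ~? w) ×-dec walk? w v k)

  -- Non-edges.  A set of unordered pairs of distinct vertices is encoded
  -- as a symmetric irreflexive relation.
  NE : Fin n → Fin n → Set
  NE a b = a ≢ b × ¬ (a ~ b)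

  NE? : ∀ a b → Dec (NE a b)
  NE? a b = ¬? (a ≟ b) ×-dec ¬? (a ~? b)

  module _ (conn : Connected) where

    -- Shortest-path metric.
    δ : Fin n → Fin n → ℕ
    δ u v = proj₁ (minimum (walk? u v) (conn u v))

    δ-isMinimum : ∀ u v → IsMinimum (Walk u v) (δ u v)
    δ-isMinimum u v = proj₂ (minimum (walk? u v) (conn u v))

    S : Fin n → Fin n → Fin n → Fin n → Set
    S u v a b = NE a b ×
      (δ u a ℕ.+ δ b v ℕ.+ 1 ℕ.< δ u v ⊎ δ u b ℕ.+ δ a v ℕ.+ 1 ℕ.< δ u v)

    S? : ∀ u v a b → Dec (S u v a b)
    S? u v a b = NE? a b ×-dec
      ((δ u a ℕ.+ δ b v ℕ.+ 1 ℕ.<? δ u v) ⊎-dec (δ u b ℕ.+ δ a v ℕ.+ 1 ℕ.<? δ u v))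

    -- A set T ⊆ V × V is a subset of Fin (n * n), with (u , v) encoded as
    -- combine u v.

    ⋃S : Subset (n ℕ.* n) → Fin n → Fin n → Set
    ⋃S T a b = ∃₂ λ u v → combine u v ∈ T × S u v a b

    ⋃S? : ∀ T a b → Dec (⋃S T a b)
    ⋃S? T a b = any? λ u → any? λ v → (combine u v ∈? T) ×-dec S? u v a b

    Certifies : Subset (n ℕ.* n) → Set
    Certifies T = ∀ a b → ⋃S T a b ⇔ NE a b

    certifies? : Decidable Certifies
    certifies? T = all? λ a → all? λ b →
      map′ (λ (f , g) → mk⇔ f g)
           (λ e → Equivalence.to e , Equivalence.from e)
           ((⋃S? T a b →-dec NE? a b) ×-dec (NE? a b →-dec ⋃S? T a b))

    CertifiableBy : ℕ → Set
    CertifiableBy m = ∃ λ T → Certifies T × ∣ T ∣ ≡ m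

    certifiableBy? : Decidable CertifiableBy
    certifiableBy? m = anySubset? λ T → certifies? T ×-dec (∣ T ∣ ℕ.≟ m)

    δ-refl : ∀ u → δ u u ≡ 0
    δ-refl u = ℕ.n≤0⇒n≡0 (proj₂ (δ-isMinimum u u) 0 [])

    NE⇒2≤δ : ∀ {a b} → NE a b → 2 ℕ.≤ δ a b
    NE⇒2≤δ {a} {b} (a≢b , a≁b) = go (proj₁ (δ-isMinimum a b))
      where
      go : ∀ {k} → Walk a b k → 2 ℕ.≤ k
      go []          = ⊥-elim (a≢b refl)
      go (e ∷ [])    = ⊥-elim (a≁b e)
      go (_ ∷ _ ∷ _) = s≤s (s≤s z≤n)

    ⊤-certifies : Certifies ⊤
    ⊤-certifies a b = mk⇔ (λ (_ , _ , _ , ne , _) → ne) λ ne →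
      a , b , ∈⊤ , ne , inj₁ (lemma ne)
      where
      lemma : NE a b → δ a a ℕ.+ δ b b ℕ.+ 1 ℕ.< δ a b
      lemma ne rewrite δ-refl a | δ-refl b = NE⇒2≤δ ne

    OPT : ℕ
    OPT = proj₁ (minimum certifiableBy? (_ , ⊤ , ⊤-certifies , refl))

    OPT-isMinimum : IsMinimum CertifiableBy OPT
    OPT-isMinimum = proj₂ (minimum certifiableBy? (_ , ⊤ , ⊤-certifies , refl))

{-# OPTIONS --safe #-}

-- Fix s and let D bound the size of balls of radius 2.  A greedy choice
-- yields O(s log n) centres A such that every cluster
-- C(w) = {u ∈ U : δ(w,u) < δ(A,u)} has at most |U| / s elements.  Query all
-- pairs in B(A,2) × U.  A non-edge {x , y} ⊆ U that these queries do not
-- settle lies in a single cell B(a,2) ∪ ⋃ {C(b) : b ∈ B(a,2)}, because all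
-- vertices b near a are at nearly the same distance from x and y.  Cells have
-- at most 2 D |U| / s elements; recurse on each.  With s = 2 D n^(1/k) there
-- are k levels, and each multiplies the number of queries by O(D log n).
-- Choosing k ≈ √(log n / (log log n + log Δ)) balances the two factors.

module Submission where

open import Defs
  using ( Graph; module Graph; Walk; []; _∷_; Connected; degree; maxDegree; NE; NE⇒2≤δ
        ; δ; δ-isMinimum; δ-refl; S; Certifies; OPT; OPT-isMinimum
        ; lower; upper; fromℕ; log; _^ℚ_; 2^ℤ; 2^_≤ℚ_; _≤ℚ2^_ )
open import Data.Fin using (Fin; zero; suc; combine; fromℕ<; toℕ)
open import Data.Fin.Properties using (toℕ-fromℕ<)
open import Data.List.Base using (List; []; _∷_; length; map; filter; _++_; concatMap; cartesianProduct; allFin)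
open import Data.List.Extrema.Nat using (xs≤max)
open import Data.List.Membership.Propositional using (_∈_)
open import Data.List.Membership.Propositional.Properties
  using (∈-filter⁺; ∈-++⁺ˡ; ∈-++⁺ʳ; ∈-concatMap⁺; ∈-cartesianProduct⁺; ∈-allFin; ∈-map⁺)
open import Data.List.Properties using (length-++; length-map; length-tabulate; length-filter)
open import Data.List.Relation.Unary.All as All using (All; []; _∷_)
open import Data.List.Relation.Unary.All.Properties using (all-filter)
open import Data.List.Relation.Unary.Any as Any using (here; there)
open import Data.Nat using (ℕ)
import Data.Nat as ℕ
import Data.Nat.Properties as ℕ
open import Data.Nat.ListAction using (sum)
open import Data.Product using (∃; ∃₂; _×_; _,_; proj₁; proj₂)
open import Data.Rational.Unnormalised.Base as ℚ using (ℚᵘ; mkℚᵘ; 0ℚᵘ; ½; ↥_; ↧ₙ_)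
import Data.Rational.Unnormalised.Properties as ℚ
open import Data.Sum.Base using (_⊎_; inj₁; inj₂; [_,_]′)
open import Function.Base using (_∘_)
open import Function.Bundles using (mk⇔)
open import Relation.Binary.PropositionalEquality using (_≡_; _≢_; refl; sym; trans; cong; cong₂; subst)
open import Relation.Nullary using (¬_; Dec; yes; no; contradiction)

-- Why few centres suffice: suppose every vertex of `W` has more than |U| / s elements in its
-- cluster. Then an average `u` lies in more than |W| / s of these clusters. Turning one of their
-- owners into a centre removes `u` from the clusters of all owners at least as far from `u`. By
-- Cauchy-Schwarz, a uniformly random member of `W` thus removes on average at least a 1/2s fraction
-- of the total cluster size, so some member does; this replaces random sampling by a deterministic
-- choice. The real exponent is never evaluated. A rational above the right-hand side comes with
-- rational approximations of all logarithms and of the root, and clearing denominators turns the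
-- estimate into inequalities between natural numbers. Rounding these approximations to integers
-- costs additive constants, which must be absorbed into a multiple of log log n; hence n ≥ 3 is
-- treated apart, where log log n is at least 1/2.

module ListSums where

  open import Data.Nat
  open import Data.Nat.Properties
  open import Data.Nat.Tactic.RingSolver using (solve-∀)
  open ≤-Reasoning

  ∑ : ∀ {A : Set} → List A → (A → ℕ) → ℕ
  ∑ xs f = sum (map f xs)

  χ : ∀ {P : Set} → Dec P → ℕ
  χ (yes _) = 1
  χ (no _)  = 0

  χ≤1 : ∀ {P : Set} (P? : Dec P) → χ P? ≤ 1
  χ≤1 (yes _) = ≤-refl
  χ≤1 (no _)  = z≤n

  χ-mono : ∀ {P Q : Set} (P? : Dec P) (Q? : Dec Q) → (P → Q) → χ P? ≤ χ Q?
  χ-mono (yes p) (yes _) _   = ≤-refl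
  χ-mono (yes p) (no ¬q) p⇒q = contradiction (p⇒q p) ¬q
  χ-mono (no _)  _       _   = z≤n

  module _ {A : Set} where

    ∑-mono : ∀ (xs : List A) {f g} → (∀ x → f x ≤ g x) → ∑ xs f ≤ ∑ xs g
    ∑-mono []       f≤g = z≤n
    ∑-mono (x ∷ xs) f≤g = +-mono-≤ (f≤g x) (∑-mono xs f≤g)

    ∑-mono-All : ∀ {xs : List A} {f g} → All (λ x → f x ≤ g x) xs → ∑ xs f ≤ ∑ xs g
    ∑-mono-All []       = z≤n
    ∑-mono-All (p ∷ ps) = +-mono-≤ p (∑-mono-All ps)

    ∑-+ : ∀ (xs : List A) f g → ∑ xs (λ x → f x + g x) ≡ ∑ xs f + ∑ xs g
    ∑-+ []       f g = refl
    ∑-+ (x ∷ xs) f g rewrite ∑-+ xs f g = interchange (f x) (g x) (∑ xs f) (∑ xs g)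
      where
      interchange : ∀ a b c d → (a + b) + (c + d) ≡ (a + c) + (b + d)
      interchange = solve-∀

    ∑-*ˡ : ∀ (xs : List A) c f → ∑ xs (λ x → c * f x) ≡ c * ∑ xs f
    ∑-*ˡ []       c f = sym (*-zeroʳ c)
    ∑-*ˡ (x ∷ xs) c f rewrite ∑-*ˡ xs c f = sym (*-distribˡ-+ c (f x) (∑ xs f))

    ∑-const : ∀ (xs : List A) c → ∑ xs (λ _ → c) ≡ length xs * c
    ∑-const []       c = refl
    ∑-const (x ∷ xs) c = cong (c +_) (∑-const xs c)

    ∑-bounded : ∀ (xs : List A) {f} c → (∀ x → f x ≤ c) → ∑ xs f ≤ length xs * c
    ∑-bounded xs c f≤c = subst (_ ≤_) (∑-const xs c) (∑-mono xs f≤c)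

    length-filter≡∑χ : ∀ {P : A → Set} (P? : ∀ x → Dec (P x)) xs → length (filter P? xs) ≡ ∑ xs (χ ∘ P?)
    length-filter≡∑χ P? []       = refl
    length-filter≡∑χ P? (x ∷ xs) with P? x
    ... | yes _ = cong suc (length-filter≡∑χ P? xs)
    ... | no _  = length-filter≡∑χ P? xs

    ∑-filter-mono : ∀ {P Q : A → Set} (P? : ∀ x → Dec (P x)) (Q? : ∀ x → Dec (Q x)) {f g} xs →
                    (∀ x → P x → Q x) → (∀ x → f x ≤ g x) → ∑ (filter P? xs) f ≤ ∑ (filter Q? xs) g
    ∑-filter-mono P? Q? []       P⇒Q f≤g = z≤n
    ∑-filter-mono P? Q? (x ∷ xs) P⇒Q f≤g with P? x | Q? x
    ... | yes _ | yes _ = +-mono-≤ (f≤g x) (∑-filter-mono P? Q? xs P⇒Q f≤g)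
    ... | yes p | no ¬q = contradiction (P⇒Q x p) ¬q
    ... | no _  | yes _ = ≤-trans (∑-filter-mono P? Q? xs P⇒Q f≤g) (m≤n+m _ _)
    ... | no _  | no _  = ∑-filter-mono P? Q? xs P⇒Q f≤g

    -- If the head fails, cancelling it leaves a strict inequality between the tail sums, so the
    -- tail is nonempty and the search continues there.
    ∑-≤⇒∃ : ∀ {xs : List A} f g → xs ≢ [] → ∑ xs f ≤ ∑ xs g → ∃ λ x → f x ≤ g x
    ∑-≤⇒∃ {[]}     f g xs≢[] ∑≤ = contradiction refl xs≢[]
    ∑-≤⇒∃ {x ∷ xs} f g _     ∑≤ with f x ≤? g x
    ... | yes fx≤gx = x , fx≤gx
    ... | no fx≰gx = rest xs refl
      where
      ∑xs≤ : ∑ xs f < ∑ xs g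
      ∑xs≤ = +-cancelˡ-< (g x) _ _ (<-≤-trans (+-monoˡ-< (∑ xs f) (≰⇒> fx≰gx)) ∑≤)
      rest : ∀ ys → ys ≡ xs → ∃ λ x → f x ≤ g x
      rest []       refl = contradiction ∑xs≤ (<-irrefl refl)
      rest (y ∷ ys) refl = ∑-≤⇒∃ {y ∷ ys} f g (λ ()) (<⇒≤ ∑xs≤)

  ∑-swap : ∀ {A B : Set} (xs : List A) (ys : List B) (f : A → B → ℕ) →
           ∑ xs (λ x → ∑ ys (f x)) ≡ ∑ ys (λ y → ∑ xs (λ x → f x y))
  ∑-swap []       ys f = sym (trans (∑-const ys 0) (*-zeroʳ (length ys)))
  ∑-swap (x ∷ xs) ys f rewrite ∑-swap xs ys f = sym (∑-+ ys (f x) (λ y → ∑ xs (λ x′ → f x′ y)))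

  2xy≤x²+y² : ∀ x y → 2 * (x * y) ≤ x * x + y * y
  2xy≤x²+y² x y with ≤-total x y
  ... | inj₁ x≤y with k , refl ← m≤n⇒∃[o]m+o≡n x≤y = begin
    2 * (x * (x + k))              ≤⟨ m≤m+n _ (k * k) ⟩
    2 * (x * (x + k)) + k * k      ≡⟨ eq x k ⟩
    x * x + (x + k) * (x + k)      ∎
    where
    eq : ∀ x k → 2 * (x * (x + k)) + k * k ≡ x * x + (x + k) * (x + k)
    eq = solve-∀
  ... | inj₂ y≤x with k , refl ← m≤n⇒∃[o]m+o≡n y≤x = begin
    2 * ((y + k) * y)              ≤⟨ m≤m+n _ (k * k) ⟩
    2 * ((y + k) * y) + k * k      ≡⟨ eq y k ⟩
    (y + k) * (y + k) + y * y      ∎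
    where
    eq : ∀ y k → 2 * ((y + k) * y) + k * k ≡ (y + k) * (y + k) + y * y
    eq = solve-∀

-- Greedy choice of centres with small clusters

module Centers (V : Set) (d : V → V → ℕ) (X U : List V) (s : ℕ) where

  open import Data.Nat
  open import Data.Nat.Properties
  open import Data.Nat.Tactic.RingSolver using (solve-∀)
  open ≤-Reasoning
  open ListSums

  cluster : (V → ℕ) → V → List V
  cluster θ w = filter (λ u → d w u <? θ u) U

  -- The initial threshold `θ` takes the place of an infinite distance to the empty set of centres;
  -- it is later the distance to one fixed vertex.
  closest : (V → ℕ) → List V → V → ℕ
  closest θ []      = θ
  closest θ (a ∷ A) = closest (λ u → θ u ⊓ d a u) A

  private
    infixl 7 _∧_
    _∧_ : (V → ℕ) → V → V → ℕ
    (θ ∧ a) u = θ u ⊓ d a u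

    α : (V → ℕ) → V → V → ℕ
    α θ w u = χ (d w u <? θ u)

    size : (V → ℕ) → V → ℕ
    size θ w = length (cluster θ w)

    size≡∑ : ∀ θ w → size θ w ≡ ∑ U (α θ w)
    size≡∑ θ w = length-filter≡∑χ (λ u → d w u <? θ u) U

    Large : (V → ℕ) → V → Set
    Large θ w = length U < s * size θ w

    large? : ∀ θ w → Dec (Large θ w)
    large? θ w = length U <? s * size θ w

    larges : (V → ℕ) → List V
    larges θ = filter (large? θ) X

    -- The potential of the greedy choice. Small clusters are left out because the averaging
    -- argument needs all clusters counted to be large.
    Φ : (V → ℕ) → ℕ
    Φ θ = ∑ (larges θ) (size θ)

    size-anti : ∀ {θ θ′} → (∀ u → θ′ u ≤ θ u) → ∀ w → size θ′ w ≤ size θ w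
    size-anti {θ} {θ′} θ′≤θ w rewrite size≡∑ θ w | size≡∑ θ′ w =
      ∑-mono U λ u → χ-mono (d w u <? θ′ u) (d w u <? θ u) (λ p → <-≤-trans p (θ′≤θ u))

    -- The part of w's cluster that adding the centre a removes.
    gain : (V → ℕ) → V → V → V → ℕ
    gain θ a w u = α θ a u * α θ w u * χ (d a u ≤? d w u)

    α-∧ : ∀ θ a w u → α (θ ∧ a) w u + gain θ a w u ≤ α θ w u
    α-∧ θ a w u with d w u <? θ u ⊓ d a u | d w u <? θ u | d a u ≤? d w u | d a u <? θ u
    ... | yes p | no ¬q | _ | _ = contradiction (<-≤-trans p (m⊓n≤m _ _)) ¬q
    ... | yes p | yes q | yes r | _ = contradiction (<-≤-trans p (m⊓n≤n _ _)) (≤⇒≯ r)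
    ... | yes p | yes q | no r | yes _ = ≤-refl
    ... | yes p | yes q | no r | no _ = ≤-refl
    ... | no _ | yes _ | r | t = subst (_≤ 1) (cong (_* χ r) (sym (*-identityʳ (χ t))))
                                  (*-mono-≤ (χ≤1 t) (χ≤1 r))
    ... | no _ | no _ | yes _ | yes _ = z≤n
    ... | no _ | no _ | yes _ | no _ = z≤n
    ... | no _ | no _ | no _ | yes _ = z≤n
    ... | no _ | no _ | no _ | no _ = z≤n

    module Step (θ : V → ℕ) (W : List V) where

      -- The size of the bunch of `u` inside `W`. Bunches are dual to clusters, so both families
      -- have the same total size.
      b : V → ℕ
      b u = ∑ W (λ w → α θ w u)

      total : ℕ
      total = ∑ W (size θ)

      total≡ : total ≡ ∑ U b
      total≡ = trans (go W) (∑-swap W U (α θ))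
        where
        go : ∀ W → ∑ W (size θ) ≡ ∑ W (λ w → ∑ U (α θ w))
        go []      = refl
        go (w ∷ W) = cong₂ _+_ (size≡∑ θ w) (go W)

      -- Of any two members of a bunch, one is at least as close to u as the other.
      b²≤ : ∀ u → b u * b u ≤ 2 * ∑ W (λ a → ∑ W (λ w → gain θ a w u))
      b²≤ u = begin
        b u * b u
          ≡⟨ ∑-*ˡ W (b u) (λ w → α θ w u) ⟨
        ∑ W (λ a → b u * α θ a u)
          ≤⟨ ∑-mono W (λ a → ≤-reflexive (trans (*-comm (b u) _) (sym (∑-*ˡ W (α θ a u) (λ w → α θ w u))))) ⟩
        ∑ W (λ a → ∑ W (λ w → α θ a u * α θ w u))
          ≤⟨ ∑-mono W (λ a → ∑-mono W (pair a)) ⟩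
        ∑ W (λ a → ∑ W (λ w → gain θ a w u + gain θ w a u))
          ≤⟨ ∑-mono W (λ a → ≤-reflexive (∑-+ W (λ w → gain θ a w u) (λ w → gain θ w a u))) ⟩
        ∑ W (λ a → ∑ W (λ w → gain θ a w u) + ∑ W (λ w → gain θ w a u))
          ≡⟨ ∑-+ W _ _ ⟩
        T + ∑ W (λ a → ∑ W (λ w → gain θ w a u))
          ≡⟨ cong (T +_) (∑-swap W W (λ a w → gain θ w a u)) ⟩
        T + T
          ≡⟨ cong (T +_) (sym (+-identityʳ T)) ⟩
        2 * T ∎
        where
        T = ∑ W (λ a → ∑ W (λ w → gain θ a w u))
        pair : ∀ a w → α θ a u * α θ w u ≤ gain θ a w u + gain θ w a u
        pair a w with d a u ≤? d w u | d w u ≤? d a u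
        ... | yes _ | r     = ≤-trans (≤-reflexive (sym (*-identityʳ _))) (m≤m+n _ _)
        ... | no p  | yes _ = ≤-trans (≤-reflexive (trans (*-comm (α θ a u) _) (sym (*-identityʳ _)))) (m≤n+m _ _)
        ... | no p  | no q  = contradiction (<⇒≤ (≰⇒> p)) q

      lost : V → ℕ
      lost a = ∑ W (λ w → ∑ U (gain θ a w))

      ∑b²≤ : ∑ U (λ u → b u * b u) ≤ 2 * ∑ W lost
      ∑b²≤ = begin
        ∑ U (λ u → b u * b u)
          ≤⟨ ∑-mono U b²≤ ⟩
        ∑ U (λ u → 2 * ∑ W (λ a → ∑ W (λ w → gain θ a w u)))
          ≡⟨ ∑-*ˡ U 2 (λ u → ∑ W (λ a → ∑ W (λ w → gain θ a w u))) ⟩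
        2 * ∑ U (λ u → ∑ W (λ a → ∑ W (λ w → gain θ a w u)))
          ≡⟨ cong (2 *_) (∑-swap U W (λ u a → ∑ W (λ w → gain θ a w u))) ⟩
        2 * ∑ W (λ a → ∑ U (λ u → ∑ W (λ w → gain θ a w u)))
          ≤⟨ *-monoʳ-≤ 2 (∑-mono W (λ a → ≤-reflexive (∑-swap U W (λ u w → gain θ a w u)))) ⟩
        2 * ∑ W lost ∎

      after : ∀ a → ∑ W (size (θ ∧ a)) + lost a ≤ total
      after a = begin
        ∑ W (size (θ ∧ a)) + lost a
          ≡⟨ ∑-+ W (size (θ ∧ a)) (λ w → ∑ U (gain θ a w)) ⟨
        ∑ W (λ w → size (θ ∧ a) w + ∑ U (gain θ a w))
          ≤⟨ ∑-mono W each ⟩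
        total ∎
        where
        each : ∀ w → size (θ ∧ a) w + ∑ U (gain θ a w) ≤ size θ w
        each w rewrite size≡∑ (θ ∧ a) w | size≡∑ θ w =
          subst (_≤ ∑ U (α θ w)) (∑-+ U (α (θ ∧ a) w) (gain θ a w)) (∑-mono U (α-∧ θ a w))

      -- Cauchy–Schwarz in the form (s b)² + |W|² ≥ 2 s b |W|, summed over U.
      average : .{{NonZero s}} → All (Large θ) W → length W * total ≤ s * ∑ U (λ u → b u * b u)
      average large = *-cancelˡ-≤ s (+-cancelʳ-≤ (s * (∣W∣ * total)) _ _ (begin
        s * (∣W∣ * total) + s * (∣W∣ * total)
          ≡⟨ eq₁ s ∣W∣ total ⟩
        2 * s * ∣W∣ * total
          ≡⟨ cong (2 * s * ∣W∣ *_) total≡ ⟩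
        2 * s * ∣W∣ * ∑ U b
          ≡⟨ ∑-*ˡ U (2 * s * ∣W∣) b ⟨
        ∑ U (λ u → 2 * s * ∣W∣ * b u)
          ≤⟨ ∑-mono U (λ u → subst (_≤ s * b u * (s * b u) + ∣W∣ * ∣W∣) (eq₂ s ∣W∣ (b u)) (2xy≤x²+y² (s * b u) ∣W∣)) ⟩
        ∑ U (λ u → s * b u * (s * b u) + ∣W∣ * ∣W∣)
          ≡⟨ ∑-+ U (λ u → s * b u * (s * b u)) (λ _ → ∣W∣ * ∣W∣) ⟩
        ∑ U (λ u → s * b u * (s * b u)) + ∑ U (λ _ → ∣W∣ * ∣W∣)
          ≤⟨ +-mono-≤ (∑-mono U (λ u → ≤-reflexive (eq₃ s (b u)))) (≤-reflexive (∑-const U (∣W∣ * ∣W∣))) ⟩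
        ∑ U (λ u → s * s * (b u * b u)) + length U * (∣W∣ * ∣W∣)
          ≡⟨ cong₂ _+_ (∑-*ˡ U (s * s) (λ u → b u * b u)) (eq₄ (length U) ∣W∣) ⟩
        s * s * ∑ U (λ u → b u * b u) + ∣W∣ * (∣W∣ * length U)
          ≤⟨ +-mono-≤ (≤-reflexive (*-assoc s s _)) (*-monoʳ-≤ ∣W∣ U≤) ⟩
        s * (s * ∑ U (λ u → b u * b u)) + ∣W∣ * (s * total)
          ≡⟨ cong (s * (s * ∑ U (λ u → b u * b u)) +_) (eq₅ ∣W∣ s total) ⟩
        s * (s * ∑ U (λ u → b u * b u)) + s * (∣W∣ * total) ∎))
        where
        ∣W∣ = length W
        -- Largeness enters here: it absorbs the summed squares of `∣W∣` into one of the two copies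
        -- of `s * (∣W∣ * total)`.
        U≤ : ∣W∣ * length U ≤ s * total
        U≤ = begin
          ∣W∣ * length U            ≡⟨ ∑-const W (length U) ⟨
          ∑ W (λ _ → length U)      ≤⟨ ∑-mono-All (All.map <⇒≤ large) ⟩
          ∑ W (λ w → s * size θ w)  ≡⟨ ∑-*ˡ W s (size θ) ⟩
          s * total                 ∎
        eq₁ : ∀ s w t → s * (w * t) + s * (w * t) ≡ 2 * s * w * t
        eq₁ = solve-∀
        eq₂ : ∀ s w x → 2 * (s * x * w) ≡ 2 * s * w * x
        eq₂ = solve-∀
        eq₃ : ∀ s x → s * x * (s * x) ≡ s * s * (x * x)
        eq₃ = solve-∀
        eq₄ : ∀ m w → m * (w * w) ≡ w * (w * m)
        eq₄ = solve-∀
        eq₅ : ∀ w s t → w * (s * t) ≡ s * (w * t)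
        eq₅ = solve-∀

      -- By `average` and `∑b²≤`, the values `2 * s * lost a` sum over `W` to at least
      -- `length W * total`; some `a` reaches the mean.
      step : .{{NonZero s}} → W ≢ [] → All (Large θ) W →
             ∃ λ a → 2 * s * ∑ W (size (θ ∧ a)) + total ≤ 2 * s * total
      step W≢[] large =
        let a , total≤ = ∑-≤⇒∃ (λ _ → total) (λ a → 2 * s * lost a) W≢[] total≤lost
        in a , loses a total≤
        where
        eq : ∀ s x → s * (2 * x) ≡ 2 * s * x
        eq = solve-∀
        total≤lost : ∑ W (λ _ → total) ≤ ∑ W (λ a → 2 * s * lost a)
        total≤lost = begin
          ∑ W (λ _ → total)              ≡⟨ ∑-const W total ⟩
          length W * total               ≤⟨ average large ⟩
          s * ∑ U (λ u → b u * b u)      ≤⟨ *-monoʳ-≤ s ∑b²≤ ⟩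
          s * (2 * ∑ W lost)             ≡⟨ eq s (∑ W lost) ⟩
          2 * s * ∑ W lost               ≡⟨ ∑-*ˡ W (2 * s) lost ⟨
          ∑ W (λ a → 2 * s * lost a)     ∎
        loses : ∀ a → total ≤ 2 * s * lost a → 2 * s * ∑ W (size (θ ∧ a)) + total ≤ 2 * s * total
        loses a total≤ = begin
          2 * s * ∑ W (size (θ ∧ a)) + total             ≤⟨ +-monoʳ-≤ (2 * s * ∑ W (size (θ ∧ a))) total≤ ⟩
          2 * s * ∑ W (size (θ ∧ a)) + 2 * s * lost a    ≡⟨ *-distribˡ-+ (2 * s) (∑ W (size (θ ∧ a))) (lost a) ⟨
          2 * s * (∑ W (size (θ ∧ a)) + lost a)          ≤⟨ *-monoʳ-≤ (2 * s) (after a) ⟩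
          2 * s * total                                  ∎

    -- The set of large vertices changes with the threshold, but it only shrinks, so summing the new
    -- sizes over the old set bounds the new potential.
    Φ-step : .{{NonZero s}} → ∀ θ → larges θ ≢ [] → ∃ λ a → 2 * s * Φ (θ ∧ a) + Φ θ ≤ 2 * s * Φ θ
    Φ-step θ larges≢[] =
      let a , Φ≤ = Step.step θ (larges θ) larges≢[] (all-filter (large? θ) X)
      in a , ≤-trans (+-monoˡ-≤ (Φ θ) (*-monoʳ-≤ (2 * s) (Φ∧≤ a))) Φ≤
      where
      anti : ∀ a w → size (θ ∧ a) w ≤ size θ w
      anti a = size-anti {θ} {θ ∧ a} (λ u → m⊓n≤m (θ u) (d a u))
      Φ∧≤ : ∀ a → Φ (θ ∧ a) ≤ ∑ (larges θ) (size (θ ∧ a))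
      Φ∧≤ a = ∑-filter-mono (large? (θ ∧ a)) (large? θ) X
                (λ w p → <-≤-trans p (*-monoʳ-≤ s (anti a w))) (λ w → ≤-refl)

    larges≡[]⇒small : ∀ θ → larges θ ≡ [] → ∀ {w} → w ∈ X → s * size θ w ≤ length U
    larges≡[]⇒small θ eq {w} w∈X with large? θ w
    ... | no ¬p = ≮⇒≥ ¬p
    ... | yes p with subst (w ∈_) eq (∈-filter⁺ (large? θ) w∈X p)
    ...   | ()

    []? : (xs : List V) → xs ≡ [] ⊎ xs ≢ []
    []? []       = inj₁ refl
    []? (x ∷ xs) = inj₂ λ ()

    0<Φ : ∀ θ → larges θ ≢ [] → 0 < Φ θ
    0<Φ θ ne with larges θ | all-filter (large? θ) X
    ... | []    | _     = contradiction refl ne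
    ... | w ∷ W | l ∷ _ = ≤-trans (0<size (size θ w) l) (m≤m+n _ _)
      where
      0<size : ∀ k → length U < s * k → 0 < k
      0<size zero    p rewrite *-zeroʳ s with () ← p
      0<size (suc k) _ = s≤s z≤n

    -- Φ loses a 1/2s fraction per centre, so 2s centres halve it; i counts
    -- the centres left until Φ < 2 ^ h.
    greedy : .{{NonZero s}} → ∀ h i θ → 2 * s * Φ θ < 2 ^ h * (2 * s + i) →
             ∃ λ A → length A ≤ i + 2 * s * h × (∀ {w} → w ∈ X → s * size (closest θ A) w ≤ length U)
    greedy-halved : .{{NonZero s}} → ∀ h i θ → larges θ ≢ [] → Φ θ < 2 ^ h →
             ∃ λ A → length A ≤ i + 2 * s * h × (∀ {w} → w ∈ X → s * size (closest θ A) w ≤ length U)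
    greedy-step : .{{NonZero s}} → ∀ h i θ → larges θ ≢ [] → 2 ^ h ≤ Φ θ → 2 * s * Φ θ < 2 ^ h * (2 * s + i) →
             ∃ λ A → length A ≤ i + 2 * s * h × (∀ {w} → w ∈ X → s * size (closest θ A) w ≤ length U)

    greedy h i θ Φ< with []? (larges θ) | 2 ^ h ≤? Φ θ
    ... | inj₁ none | _      = [] , z≤n , larges≡[]⇒small θ none
    ... | inj₂ some | no Φ≱  = greedy-halved h i θ some (≰⇒> Φ≱)
    ... | inj₂ some | yes Φ≥ = greedy-step h i θ some Φ≥ Φ<

    greedy-halved zero    i θ some Φ< = contradiction (0<Φ θ some) (<⇒≱ Φ<)
    -- A new phase starts, with one power of two fewer and a fresh budget of `2 * s` centres.
    greedy-halved (suc h) i θ some Φ< =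
      let A , ∣A∣≤ , small = greedy h (2 * s) θ invariant
      in A , ≤-trans ∣A∣≤ (≤-trans (≤-reflexive (sym (*-suc (2 * s) h))) (m≤n+m _ i)) , small
      where
      eq : ∀ s p → 2 * s * (2 * p) ≡ p * (2 * s + 2 * s)
      eq = solve-∀
      invariant : 2 * s * Φ θ < 2 ^ h * (2 * s + 2 * s)
      invariant = begin-strict
        2 * s * Φ θ                 <⟨ *-monoʳ-< (2 * s) {{m*n≢0 2 s}} Φ< ⟩
        2 * s * 2 ^ suc h           ≡⟨ eq s (2 ^ h) ⟩
        2 ^ h * (2 * s + 2 * s)     ∎

    greedy-step h zero θ some Φ≥ Φ< =
      contradiction (*-monoʳ-≤ (2 * s) Φ≥)
        (<⇒≱ (subst (2 * s * Φ θ <_) (trans (cong (2 ^ h *_) (+-identityʳ (2 * s))) (*-comm (2 ^ h) (2 * s))) Φ<))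
    greedy-step h (suc i) θ some Φ≥ Φ< =
      let a , Φ∧≤ = Φ-step θ some
          A , ∣A∣≤ , small = greedy h i (θ ∧ a) (invariant a Φ∧≤)
      in a ∷ A , s≤s ∣A∣≤ , small
      where
      eq : ∀ p x i → p * (x + (1 + i)) ≡ p * (x + i) + p
      eq = solve-∀
      -- While the potential is at least 2 ^ h, one centre lowers `2 * s * Φ` by at least 2 ^ h,
      -- which pays for decrementing `i`.
      invariant : ∀ a → 2 * s * Φ (θ ∧ a) + Φ θ ≤ 2 * s * Φ θ → 2 * s * Φ (θ ∧ a) < 2 ^ h * (2 * s + i)
      invariant a Φ∧≤ = +-cancelʳ-< (2 ^ h) _ _ (begin-strict
        2 * s * Φ (θ ∧ a) + 2 ^ h      ≤⟨ +-monoʳ-≤ (2 * s * Φ (θ ∧ a)) Φ≥ ⟩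
        2 * s * Φ (θ ∧ a) + Φ θ        ≤⟨ Φ∧≤ ⟩
        2 * s * Φ θ                    <⟨ Φ< ⟩
        2 ^ h * (2 * s + suc i)        ≡⟨ eq (2 ^ h) (2 * s) i ⟩
        2 ^ h * (2 * s + i) + 2 ^ h    ∎)

  -- The potential starts at no more than `length X * length U`, so `h` halvings at `2 * s` centres
  -- each bring it below 1.
  centers : .{{NonZero s}} → ∀ h θ → length X * length U < 2 ^ h →
            ∃ λ A → length A ≤ 2 * s * h ×
                    (∀ {w} → w ∈ X → s * length (cluster (closest θ A) w) ≤ length U)
  centers h θ XU< = greedy h 0 θ (begin-strict
    2 * s * Φ θ              <⟨ *-monoʳ-< (2 * s) {{m*n≢0 2 s}} (≤-<-trans Φ≤ XU<) ⟩
    2 * s * 2 ^ h            ≡⟨ *-comm (2 * s) (2 ^ h) ⟩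
    2 ^ h * (2 * s)          ≡⟨ cong (2 ^ h *_) (+-identityʳ (2 * s)) ⟨
    2 ^ h * (2 * s + 0)      ∎)
    where
    Φ≤ : Φ θ ≤ length X * length U
    Φ≤ = ≤-trans (∑-bounded (larges θ) (length U) (λ w → length-filter (λ u → d w u <? θ u) U))
                 (*-monoˡ-≤ (length U) (length-filter (large? θ) X))

  closest-attained : ∀ θ A u → closest θ A u ≡ θ u ⊎ ∃ λ a → a ∈ A × closest θ A u ≡ d a u
  closest-attained θ []      u = inj₁ refl
  closest-attained θ (a ∷ A) u with closest-attained (θ ∧ a) A u
  ... | inj₂ (a′ , a′∈A , eq) = inj₂ (a′ , there a′∈A , eq)
  ... | inj₁ eq with ⊓-sel (θ u) (d a u)
  ...   | inj₁ eq′ = inj₁ (trans eq eq′)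
  ...   | inj₂ eq′ = inj₂ (a , here refl , trans eq eq′)

-- Subsets obtained from lists

module Subsets where

  open import Data.Fin.Subset using (Subset; inside; outside; ∣_∣; ⁅_⁆; _∪_; ⊥) renaming (_∈_ to _∈ˢ_)
  open import Data.Fin.Subset.Properties
  open import Data.Nat
  open import Data.Nat.Properties
  open import Data.Vec.Base using ([]; _∷_)

  ∣p∪q∣≤∣p∣+∣q∣ : ∀ {n} (p q : Subset n) → ∣ p ∪ q ∣ ≤ ∣ p ∣ + ∣ q ∣
  ∣p∪q∣≤∣p∣+∣q∣ []            []            = z≤n
  ∣p∪q∣≤∣p∣+∣q∣ (inside  ∷ p) (inside  ∷ q) = s≤s (≤-trans (∣p∪q∣≤∣p∣+∣q∣ p q) (+-monoʳ-≤ ∣ p ∣ (n≤1+n ∣ q ∣)))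
  ∣p∪q∣≤∣p∣+∣q∣ (inside  ∷ p) (outside ∷ q) = s≤s (∣p∪q∣≤∣p∣+∣q∣ p q)
  ∣p∪q∣≤∣p∣+∣q∣ (outside ∷ p) (inside  ∷ q) rewrite +-suc ∣ p ∣ ∣ q ∣ = s≤s (∣p∪q∣≤∣p∣+∣q∣ p q)
  ∣p∪q∣≤∣p∣+∣q∣ (outside ∷ p) (outside ∷ q) = ∣p∪q∣≤∣p∣+∣q∣ p q

  fromList : ∀ {n} → List (Fin n) → Subset n
  fromList []       = ⊥
  fromList (x ∷ xs) = ⁅ x ⁆ ∪ fromList xs

  ∣fromList∣≤length : ∀ {n} (xs : List (Fin n)) → ∣ fromList xs ∣ ≤ length xs
  ∣fromList∣≤length {n} []   = ≤-reflexive (∣⊥∣≡0 n)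
  ∣fromList∣≤length (x ∷ xs) = ≤-trans (∣p∪q∣≤∣p∣+∣q∣ ⁅ x ⁆ (fromList xs))
    (+-mono-≤ (≤-reflexive (∣⁅x⁆∣≡1 x)) (∣fromList∣≤length xs))

  ∈-fromList⁺ : ∀ {n} {x : Fin n} {xs} → x ∈ xs → x ∈ˢ fromList xs
  ∈-fromList⁺ {x = x} (here refl) = x∈p∪q⁺ (inj₁ (x∈⁅x⁆ x))
  ∈-fromList⁺ (there x∈xs)        = x∈p∪q⁺ (inj₂ (∈-fromList⁺ x∈xs))

-- Lengths of concatenations and products

module Lengths where

  open import Data.Nat
  open import Data.Nat.Properties
  open ≤-Reasoning

  -- The factor `c` lets bounds of the form m / c be summed without division.
  length-concatMap-≤ : ∀ {A B : Set} c m (f : A → List B) → (∀ x → c * length (f x) ≤ m) →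
                       ∀ xs → c * length (concatMap f xs) ≤ length xs * m
  length-concatMap-≤ c m f f≤ []       = ≤-reflexive (*-zeroʳ c)
  length-concatMap-≤ c m f f≤ (x ∷ xs) = begin
    c * length (f x ++ concatMap f xs)                ≡⟨ cong (c *_) (length-++ (f x)) ⟩
    c * (length (f x) + length (concatMap f xs))      ≡⟨ *-distribˡ-+ c (length (f x)) _ ⟩
    c * length (f x) + c * length (concatMap f xs)    ≤⟨ +-mono-≤ (f≤ x) (length-concatMap-≤ c m f f≤ xs) ⟩
    m + length xs * m                                 ∎

  length-cartesianProduct : ∀ {A B : Set} (xs : List A) (ys : List B) →
                            length (cartesianProduct xs ys) ≡ length xs * length ys
  length-cartesianProduct []       ys = refl
  length-cartesianProduct (x ∷ xs) ys = trans (length-++ (map (x ,_) ys))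
    (cong₂ _+_ (length-map (x ,_) ys) (length-cartesianProduct xs ys))

-- Cells, the recursion on them, and the resulting bound on OPT

module Covering {n : ℕ} (G : Graph n) (conn : Connected G) where

  open import Data.Nat
  open import Data.Nat.Properties
  open import Data.Nat.Tactic.RingSolver using (solve-∀)
  open ≤-Reasoning
  open Graph G
  open Lengths

  V : Set
  V = Fin n

  dist : V → V → ℕ
  dist = δ G conn

  dist-walk : ∀ u v → Walk G u v (dist u v)
  dist-walk u v = proj₁ (δ-isMinimum G conn u v)

  dist-minimal : ∀ {u v k} → Walk G u v k → dist u v ≤ k
  dist-minimal {u} {v} p = proj₂ (δ-isMinimum G conn u v) _ p

  Covers : List (V × V) → V → V → Set
  Covers T a b = ∃₂ λ u v → (u , v) ∈ T × S G conn u v a b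

  CoversAll : List (V × V) → List V → Set
  CoversAll T U = ∀ {x y} → x ∈ U → y ∈ U → NE G x y → Covers T x y

  Covers-⊆ : ∀ {T T′} → (∀ {q} → q ∈ T → q ∈ T′) → ∀ {x y} → Covers T x y → Covers T′ x y
  Covers-⊆ T⊆T′ (u , v , uv∈T , uv-covers) = u , v , T⊆T′ uv∈T , uv-covers

  NE-sym : ∀ {a b} → NE G a b → NE G b a
  NE-sym (a≢b , a≁b) = a≢b ∘ sym , a≁b ∘ ~-sym

  Covers-sym : ∀ {T a b} → Covers T a b → Covers T b a
  Covers-sym (u , v , uv∈T , ne , inj₁ p) = u , v , uv∈T , NE-sym ne , inj₂ p
  Covers-sym (u , v , uv∈T , ne , inj₂ p) = u , v , uv∈T , NE-sym ne , inj₁ p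

  -- Querying (u , y) settles {x , y} unless it fits an edge between x and y.
  query : ∀ u {x y} → NE G x y → S G conn u y x y ⊎ dist u y ≤ suc (dist u x)
  query u {x} {y} ne with suc (dist u x) <? dist u y
  ... | no ≮  = inj₂ (≮⇒≥ ≮)
  ... | yes < = inj₁ (ne , inj₁ (subst (_< dist u y) eq <))
    where
    eq : suc (dist u x) ≡ dist u x + dist y y + 1
    eq rewrite δ-refl G conn y | +-identityʳ (dist u x) = +-comm 1 (dist u x)

  -- Querying a non-edge at its own endpoints settles it, since they are at distance at least 2.
  cartesianProduct-coversAll : ∀ U → CoversAll (cartesianProduct U U) U
  cartesianProduct-coversAll U {x} {y} x∈U y∈U ne with query x ne
  ... | inj₁ covers = x , y , ∈-cartesianProduct⁺ x∈U y∈U , covers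
  ... | inj₂ ≤ rewrite δ-refl G conn x = contradiction (NE⇒2≤δ G conn ne) (<⇒≱ (s≤s ≤))

  neighbours : V → List V
  neighbours v = filter (v ~?_) (allFin n)

  ∈-neighbours⁺ : ∀ {u v} → u ~ v → v ∈ neighbours u
  ∈-neighbours⁺ {u} e = ∈-filter⁺ (u ~?_) (∈-allFin _) e

  length-neighbours : ∀ v → length (neighbours v) ≤ maxDegree G
  length-neighbours v = All.lookup (xs≤max 0 (map (degree G) (allFin n))) (∈-map⁺ (degree G) (∈-allFin v))

  ball : V → List V
  ball a = a ∷ neighbours a ++ concatMap neighbours (neighbours a)

  length-ball : ∀ a → length (ball a) ≤ 1 + maxDegree G + maxDegree G * maxDegree G
  length-ball a rewrite length-++ (neighbours a) {concatMap neighbours (neighbours a)} =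
    s≤s (+-mono-≤ (length-neighbours a) (begin
      length (concatMap neighbours (neighbours a))        ≡⟨ +-identityʳ _ ⟨
      1 * length (concatMap neighbours (neighbours a))
        ≤⟨ length-concatMap-≤ 1 Δ neighbours (λ x → subst (_≤ Δ) (sym (+-identityʳ _)) (length-neighbours x)) (neighbours a) ⟩
      length (neighbours a) * Δ                           ≤⟨ *-monoˡ-≤ Δ (length-neighbours a) ⟩
      Δ * Δ                                               ∎))
    where Δ = maxDegree G

  ∈-ball₂ : ∀ {a b c} → a ~ b → b ~ c → c ∈ ball a
  ∈-ball₂ {a} e f = there (∈-++⁺ʳ (neighbours a)
    (∈-concatMap⁺ neighbours (Any.map (λ where refl → ∈-neighbours⁺ f) (∈-neighbours⁺ e))))

  walk-∈-ball : ∀ {a x k} → Walk G a x k → k ≤ 2 → x ∈ ball a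
  walk-∈-ball []              _ = here refl
  walk-∈-ball (e ∷ [])        _ = there (∈-++⁺ˡ (∈-neighbours⁺ e))
  walk-∈-ball (e ∷ f ∷ [])    _ = ∈-ball₂ e f
  walk-∈-ball (_ ∷ _ ∷ _ ∷ _) (s≤s (s≤s ()))

  -- Used on a shortest walk from a centre: either `x` is very close, or two edges along the walk
  -- gain a margin of 2.
  walk-via-ball : ∀ {a x k} → Walk G a x k → k ≤ 1 ⊎ (∃ λ b → b ∈ ball a × 2 + dist b x ≤ k)
  walk-via-ball []          = inj₁ z≤n
  walk-via-ball (e ∷ [])    = inj₁ ≤-refl
  walk-via-ball (e ∷ f ∷ p) = inj₂ (_ , ∈-ball₂ e f , s≤s (s≤s (dist-minimal p)))

  module _ (s : ℕ) (U : List V) where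

    open Centers V dist (allFin n) U s

    cell : (V → ℕ) → V → List V
    cell θ a = ball a ++ concatMap (cluster θ) (ball a)

    queries : List V → List (V × V)
    queries A = cartesianProduct (concatMap ball A) U

    ∈-queries⁺ : ∀ {A a b u} → a ∈ A → b ∈ ball a → u ∈ U → (b , u) ∈ queries A
    ∈-queries⁺ a∈A b∈ball u∈U = ∈-cartesianProduct⁺ (∈-concatMap⁺ ball (Any.map (λ where refl → b∈ball) a∈A)) u∈U

    ∈-cell⁺ : ∀ {θ a b u} → b ∈ ball a → u ∈ U → dist b u < θ u → u ∈ cell θ a
    ∈-cell⁺ {θ} {a} {b} b∈ball u∈U < = ∈-++⁺ʳ (ball a)
      (∈-concatMap⁺ (cluster θ) (Any.map (λ where refl → ∈-filter⁺ (λ u → dist b u <? θ u) u∈U <) b∈ball))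

    -- The centre a nearest to x works, where x is the endpoint closer to the
    -- centres.  Unless x is adjacent to a, step from a towards x by two edges.
    -- The vertex b reached has x in its cluster with a margin of 2, and by the
    -- query (b , y) the vertex y is at most 1 farther from b than x is.
    covered-or-in-cell′ : ∀ {A} θ → (∀ u → ∃ λ a → a ∈ A × θ u ≡ dist a u) →
      ∀ {x y} → x ∈ U → y ∈ U → NE G x y → θ x ≤ θ y →
      Covers (queries A) x y ⊎ ∃ λ a → a ∈ A × x ∈ cell θ a × y ∈ cell θ a
    covered-or-in-cell′ θ nearest {x} {y} x∈U y∈U ne θx≤θy
      with a , a∈A , θx≡ ← nearest x
      with query a ne | walk-via-ball (dist-walk a x)
    ... | inj₁ covers | _ = inj₁ (a , y , ∈-queries⁺ a∈A (here refl) y∈U , covers)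
    -- Here `x` is within 1 of the centre and the unsettled query puts `y` within 2, so the ball
    -- alone contains both.
    ... | inj₂ ay≤ | inj₁ ax≤1 = inj₂ (a , a∈A ,
      ∈-++⁺ˡ (walk-∈-ball (dist-walk a x) (m≤n⇒m≤1+n ax≤1)) ,
      ∈-++⁺ˡ (walk-∈-ball (dist-walk a y) (≤-trans ay≤ (s≤s ax≤1))))
    ... | inj₂ _ | inj₂ (b , b∈ball , bx≤) with query b ne
    ...   | inj₁ covers = inj₁ (b , y , ∈-queries⁺ a∈A b∈ball y∈U , covers)
    ...   | inj₂ by≤ = inj₂ (a , a∈A , ∈-cell⁺ b∈ball x∈U bx<θx , ∈-cell⁺ b∈ball y∈U (begin-strict
      dist b y            ≤⟨ by≤ ⟩
      suc (dist b x)      <⟨ bx≤ ⟩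
      dist a x            ≡⟨ θx≡ ⟨
      θ x                 ≤⟨ θx≤θy ⟩
      θ y                 ∎))
      where
      bx<θx : dist b x < θ x
      bx<θx = subst (dist b x <_) (sym θx≡) (≤-trans (n≤1+n _) bx≤)

    covered-or-in-cell : ∀ {A} θ → (∀ u → ∃ λ a → a ∈ A × θ u ≡ dist a u) →
      ∀ {x y} → x ∈ U → y ∈ U → NE G x y →
      Covers (queries A) x y ⊎ ∃ λ a → a ∈ A × x ∈ cell θ a × y ∈ cell θ a
    covered-or-in-cell θ nearest {x} {y} x∈U y∈U ne with ≤-total (θ x) (θ y)
    ... | inj₁ ≤ = covered-or-in-cell′ θ nearest x∈U y∈U ne ≤
    ... | inj₂ ≥ with covered-or-in-cell′ θ nearest y∈U x∈U (NE-sym ne) ≥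
    ...   | inj₁ covers = inj₁ (Covers-sym covers)
    ...   | inj₂ (a , a∈A , y∈ , x∈) = inj₂ (a , a∈A , x∈ , y∈)

  module Recursion (D r h : ℕ) .{{_ : NonZero D}} .{{_ : NonZero r}} .{{_ : NonZero h}}
    (ball≤ : ∀ a → length (ball a) ≤ D) (n²<2^h : n * n < 2 ^ h) where

    -- A cell has at most `D + D * length U / s` elements. Once `s ≤ length U`, this is at most
    -- `2 * D * length U / s`, so the factor `2 * D` makes cells smaller than `U` by a factor `r`.
    s : ℕ
    s = 2 * D * r

    -- The growth of the query count per level: one share of `3 * h * D` for the queries made at the
    -- level, two for those made inside the cells.
    c : ℕ
    c = 3 * (3 * h) * D

    instance
      2D≢0 : NonZero (2 * D)
      2D≢0 = m*n≢0 2 D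
      s≢0 : NonZero s
      s≢0 = m*n≢0 (2 * D) r
      c≢0 : NonZero c
      c≢0 = m*n≢0 (3 * (3 * h)) D {{m*n≢0 3 (3 * h) {{_}} {{m*n≢0 3 h}}}}

    β : ℕ → ℕ
    β k = s * c ^ k

    s≤β : ∀ k → s ≤ β k
    s≤β k = m≤m*n s (c ^ k) {{m^n≢0 c k}}

    record Cells (U : List V) : Set where
      field
        A       : List V
        C       : V → List V
        ∣A∣≤    : length A ≤ s * (3 * h)
        ∣C∣≤    : ∀ a → s * length (C a) ≤ s * D + D * length U
        covered : ∀ {x y} → x ∈ U → y ∈ U → NE G x y →
                  Covers (queries s U A) x y ⊎ ∃ λ a → a ∈ A × x ∈ C a × y ∈ C a

    -- Centres are chosen against all vertices of the graph, since a cell uses clusters of arbitrary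
    -- vertices near a centre; hence `h` is measured by n². The vertex `a₀` supplies the initial
    -- threshold and counts as a centre, so `θ` is always the distance to an actual centre.
    cells : ∀ a₀ U → length U ≤ n → Cells U
    cells a₀ U ∣U∣≤n = record
      { A       = a₀ ∷ A
      ; C       = cell s U θ
      ; ∣A∣≤    = begin
          1 + length A              ≤⟨ +-mono-≤ (>-nonZero⁻¹ (s * h) {{m*n≢0 s h}}) ∣A∣≤ ⟩
          s * h + 2 * s * h         ≡⟨ eq s h ⟩
          s * (3 * h)               ∎
      ; ∣C∣≤    = λ a → begin
          s * length (cell s U θ a)
            ≡⟨ trans (cong (s *_) (length-++ (ball a))) (*-distribˡ-+ s _ _) ⟩
          s * length (ball a) + s * length (concatMap (cluster θ) (ball a))
            ≤⟨ +-mono-≤ (*-monoʳ-≤ s (ball≤ a))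
                        (length-concatMap-≤ s (length U) (cluster θ) (λ w → small (∈-allFin w)) (ball a)) ⟩
          s * D + length (ball a) * length U
            ≤⟨ +-monoʳ-≤ (s * D) (*-monoˡ-≤ (length U) (ball≤ a)) ⟩
          s * D + D * length U ∎
      ; covered = covered-or-in-cell s U θ nearest
      }
      where
      open Centers V dist (allFin n) U s
      nU<2^h : length (allFin n) * length U < 2 ^ h
      nU<2^h = ≤-<-trans (*-mono-≤ (≤-reflexive (length-tabulate {n = n} (λ i → i))) ∣U∣≤n) n²<2^h
      found = centers h (dist a₀) nU<2^h
      A = proj₁ found
      ∣A∣≤ = proj₁ (proj₂ found)
      small = proj₂ (proj₂ found)
      θ = closest (dist a₀) A
      nearest : ∀ u → ∃ λ a → a ∈ a₀ ∷ A × θ u ≡ dist a u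
      nearest u = [ (λ eq → a₀ , here refl , eq) , (λ (a , a∈A , eq) → a , there a∈A , eq) ]′
                  (closest-attained (dist a₀) A u)
      eq : ∀ s h → s * h + 2 * s * h ≡ s * (3 * h)
      eq = solve-∀

    -- Cells may overlap, so their sizes are not summed against `length U` directly. The bound is
    -- linear in `length U` instead: at most `2 * D * r * (3 * h)` cells of at most `length U / r`
    -- elements contribute a sum from which `r` cancels.
    cover : ∀ k U → length U ≤ n → length U ≤ s * r ^ k →
            ∃ λ T → length T ≤ β k * length U × CoversAll T U

    cover-pairs : ∀ k U → length U ≤ s → ∃ λ T → length T ≤ β k * length U × CoversAll T U
    cover-pairs k U ∣U∣≤s = cartesianProduct U U ,
      subst (_≤ β k * length U) (sym (length-cartesianProduct U U)) (*-monoˡ-≤ (length U) (≤-trans ∣U∣≤s (s≤β k))) ,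
      cartesianProduct-coversAll U

    cover-cells : ∀ k U → length U ≤ n → s ≤ length U → length U ≤ s * r ^ suc k → Cells U →
                  ∃ λ T → length T ≤ β (suc k) * length U × CoversAll T U
    cover-cells k U ∣U∣≤n s≤∣U∣ ∣U∣≤ cs = queries s U A ++ concatMap T A , ∣T∣≤ , coversAll
      where
      open Cells cs
      m = length U
      r∣C∣≤ : ∀ a → r * length (C a) ≤ m
      r∣C∣≤ a = *-cancelˡ-≤ (2 * D) (begin
        2 * D * (r * length (C a))     ≡⟨ *-assoc (2 * D) r _ ⟨
        s * length (C a)               ≤⟨ ∣C∣≤ a ⟩
        s * D + D * m                  ≤⟨ +-monoˡ-≤ (D * m) (*-monoˡ-≤ D s≤∣U∣) ⟩
        m * D + D * m                  ≡⟨ eq m D ⟩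
        2 * D * m                      ∎)
        where
        eq : ∀ m D → m * D + D * m ≡ 2 * D * m
        eq = solve-∀
      sub : ∀ a → ∃ λ T → length T ≤ β k * length (C a) × CoversAll T (C a)
      sub a = cover k (C a) (≤-trans (m≤n*m _ r) (≤-trans (r∣C∣≤ a) ∣U∣≤n)) (*-cancelˡ-≤ r (begin
        r * length (C a)     ≤⟨ r∣C∣≤ a ⟩
        m                    ≤⟨ ∣U∣≤ ⟩
        s * (r * r ^ k)      ≡⟨ eq s r (r ^ k) ⟩
        r * (s * r ^ k)      ∎))
        where
        eq : ∀ s r x → s * (r * x) ≡ r * (s * x)
        eq = solve-∀
      T : V → List (V × V)
      T a = proj₁ (sub a)
      ∣queries∣≤ : length (queries s U A) ≤ β k * (3 * h * D) * m
      ∣queries∣≤ = begin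
        length (queries s U A)                  ≡⟨ length-cartesianProduct (concatMap ball A) U ⟩
        length (concatMap ball A) * m           ≡⟨ cong (_* m) (+-identityʳ (length (concatMap ball A))) ⟨
        1 * length (concatMap ball A) * m
          ≤⟨ *-monoˡ-≤ m (length-concatMap-≤ 1 D ball (λ a → subst (_≤ D) (sym (+-identityʳ _)) (ball≤ a)) A) ⟩
        length A * D * m                        ≤⟨ *-monoˡ-≤ m (*-monoˡ-≤ D ∣A∣≤) ⟩
        s * (3 * h) * D * m                     ≤⟨ *-monoˡ-≤ m (*-monoˡ-≤ D (*-monoˡ-≤ (3 * h) (s≤β k))) ⟩
        β k * (3 * h) * D * m                   ≡⟨ cong (_* m) (*-assoc (β k) (3 * h) D) ⟩
        β k * (3 * h * D) * m                   ∎
      ∣T∣s≤ : length (concatMap T A) ≤ 2 * D * (3 * h) * (β k * m)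
      ∣T∣s≤ = *-cancelˡ-≤ r (begin
        r * length (concatMap T A)
          ≤⟨ length-concatMap-≤ r (β k * m) T each A ⟩
        length A * (β k * m)
          ≤⟨ *-monoˡ-≤ (β k * m) ∣A∣≤ ⟩
        2 * D * r * (3 * h) * (β k * m)
          ≡⟨ eq₂ D r (3 * h) (β k * m) ⟩
        r * (2 * D * (3 * h) * (β k * m)) ∎)
        where
        eq₁ : ∀ r b x → r * (b * x) ≡ b * (r * x)
        eq₁ = solve-∀
        eq₂ : ∀ D r l x → 2 * D * r * l * x ≡ r * (2 * D * l * x)
        eq₂ = solve-∀
        each : ∀ a → r * length (T a) ≤ β k * m
        each a = begin
          r * length (T a)            ≤⟨ *-monoʳ-≤ r (proj₁ (proj₂ (sub a))) ⟩
          r * (β k * length (C a))    ≡⟨ eq₁ r (β k) (length (C a)) ⟩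
          β k * (r * length (C a))    ≤⟨ *-monoʳ-≤ (β k) (r∣C∣≤ a) ⟩
          β k * m                     ∎
      ∣T∣≤ : length (queries s U A ++ concatMap T A) ≤ β (suc k) * m
      ∣T∣≤ = begin
        length (queries s U A ++ concatMap T A)
          ≡⟨ length-++ (queries s U A) ⟩
        length (queries s U A) + length (concatMap T A)
          ≤⟨ +-mono-≤ ∣queries∣≤ ∣T∣s≤ ⟩
        s * x * (3 * h * D) * m + 2 * D * (3 * h) * (s * x * m)
          ≡⟨ eq s x (3 * h) D m ⟩
        s * (3 * (3 * h) * D * x) * m ∎
        where
        x = c ^ k
        eq : ∀ s x l D m → s * x * (l * D) * m + 2 * D * l * (s * x * m) ≡ s * (3 * l * D * x) * m
        eq = solve-∀
      coversAll : CoversAll (queries s U A ++ concatMap T A) U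
      coversAll x∈U y∈U ne = [ Covers-⊆ ∈-++⁺ˡ , in-cell ne ]′ (covered x∈U y∈U ne)
        where
        in-cell : ∀ {x y} → NE G x y → (∃ λ a → a ∈ A × x ∈ C a × y ∈ C a) → Covers (queries s U A ++ concatMap T A) x y
        in-cell ne (a , a∈A , x∈C , y∈C) =
          Covers-⊆ {T a} (λ q∈T → ∈-++⁺ʳ (queries s U A) (∈-concatMap⁺ T (Any.map (λ where refl → q∈T) a∈A)))
                   (proj₂ (proj₂ (sub a)) x∈C y∈C ne)

    cover zero    U _ ∣U∣≤ = cover-pairs 0 U (subst (length U ≤_) (*-identityʳ s) ∣U∣≤)
    -- An empty list has no vertex to serve as `a₀`.
    cover (suc k) [] _ _ = [] , z≤n , λ ()
    cover (suc k) U@(a₀ ∷ _) ∣U∣≤n ∣U∣≤ with length U ≤? s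
    ... | yes ∣U∣≤s = cover-pairs (suc k) U ∣U∣≤s
    ... | no ∣U∣≰s  = cover-cells k U ∣U∣≤n (<⇒≤ (≰⇒> ∣U∣≰s)) ∣U∣≤ (cells a₀ U ∣U∣≤n)

  OPT-≤ : ∀ T → CoversAll T (allFin n) → OPT G conn ≤ length T
  OPT-≤ T covers = begin
    OPT G conn                 ≤⟨ proj₂ (OPT-isMinimum G conn) ∣ T′ ∣ (T′ , certifies , refl) ⟩
    ∣ T′ ∣                     ≤⟨ ∣fromList∣≤length (map pair T) ⟩
    length (map pair T)        ≡⟨ length-map pair T ⟩
    length T                   ∎
    where
    open Subsets
    open import Data.Fin.Subset using (∣_∣)
    pair : V × V → Fin (n * n)
    pair (u , v) = combine u v
    T′ = fromList (map pair T)
    certifies : Certifies G conn T′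
    certifies a b = mk⇔ (λ (_ , _ , _ , ne , _) → ne) λ ne →
      let u , v , uv∈T , uv-covers = covers (∈-allFin a) (∈-allFin b) ne
      in u , v , ∈-fromList⁺ (∈-map⁺ pair uv∈T) , uv-covers

  length-allFin : length (allFin n) ≡ n
  length-allFin = length-tabulate (λ i → i)

  OPT≤n² : OPT G conn ≤ n * n
  OPT≤n² = subst (OPT G conn ≤_)
    (trans (length-cartesianProduct (allFin n) (allFin n)) (cong₂ _*_ length-allFin length-allFin))
    (OPT-≤ (cartesianProduct (allFin n) (allFin n)) (cartesianProduct-coversAll (allFin n)))

  OPT-bound : ∀ D r h k .{{_ : NonZero D}} .{{_ : NonZero r}} .{{_ : NonZero h}} →
              1 + maxDegree G + maxDegree G * maxDegree G ≤ D → n * n < 2 ^ h → n ≤ r ^ k →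
              OPT G conn ≤ 2 * D * r * (3 * (3 * h) * D) ^ k * n
  OPT-bound D r h k D≥ n²< n≤ =
    let T , ∣T∣≤ , covers = cover k (allFin n) (≤-reflexive length-allFin)
                              (≤-trans (≤-reflexive length-allFin) (≤-trans n≤ (m≤n*m (r ^ k) s)))
    in ≤-trans (OPT-≤ T covers) (subst (λ l → length T ≤ β k * l) length-allFin ∣T∣≤)
    where open Recursion D r h (λ a → ≤-trans (length-ball a) D≥) n²<

-- Powers, rounding up and binary logarithms

module Powers where

  open import Data.Nat
  open import Data.Nat.DivMod
  open import Data.Nat.Properties
  open ≤-Reasoning

  ^-cancelʳ-≤ : ∀ b {i j} → 1 < b → b ^ i ≤ b ^ j → i ≤ j
  ^-cancelʳ-≤ b 1<b p = ≮⇒≥ λ j<i → <⇒≱ (^-monoʳ-< b 1<b j<i) p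

  ^-cancelˡ-≤ : ∀ d {a b} .{{_ : NonZero d}} → a ^ d ≤ b ^ d → a ≤ b
  ^-cancelˡ-≤ d p = ≮⇒≥ λ b<a → <⇒≱ (^-monoˡ-< d b<a) p

  ^-comm : ∀ a m n → (a ^ m) ^ n ≡ (a ^ n) ^ m
  ^-comm a m n = trans (^-*-assoc a m n) (trans (cong (a ^_) (*-comm m n)) (sym (^-*-assoc a n m)))

  ^-distribʳ-* : ∀ m n o → (m * n) ^ o ≡ m ^ o * n ^ o
  ^-distribʳ-* m n zero    = refl
  ^-distribʳ-* m n (suc o) rewrite ^-distribʳ-* m n o = eq m n (m ^ o) (n ^ o)
    where
    open import Data.Nat.Tactic.RingSolver using (solve-∀)
    eq : ∀ a b c d → a * b * (c * d) ≡ a * c * (b * d)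
    eq = solve-∀

  -- A substitute for the ceiling of p / d: it is positive, hence itself a legal divisor, and
  -- overshoots by at most 1.
  quot⁺ : (p d : ℕ) .{{_ : NonZero d}} → ℕ
  quot⁺ p d = suc (p / d)

  quot⁺-upper : ∀ p d .{{_ : NonZero d}} → p ≤ quot⁺ p d * d
  quot⁺-upper p d = begin
    p                        ≡⟨ m≡m%n+[m/n]*n p d ⟩
    p % d + p / d * d        ≤⟨ +-monoˡ-≤ (p / d * d) (<⇒≤ (m%n<n p d)) ⟩
    d + p / d * d            ∎

  quot⁺-lower : ∀ p d .{{_ : NonZero d}} → quot⁺ p d * d ≤ p + d
  quot⁺-lower p d = ≤-trans (+-monoʳ-≤ d (m/n*n≤m p d)) (≤-reflexive (+-comm d p))

  ≤2^quot⁺ : ∀ {a p d} .{{_ : NonZero d}} → a ^ d ≤ 2 ^ p → a ≤ 2 ^ quot⁺ p d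
  ≤2^quot⁺ {a} {p} {d} a^d≤ = ^-cancelˡ-≤ d (begin
    a ^ d                     ≤⟨ a^d≤ ⟩
    2 ^ p                     ≤⟨ ^-monoʳ-≤ 2 (quot⁺-upper p d) ⟩
    2 ^ (quot⁺ p d * d)       ≡⟨ ^-*-assoc 2 (quot⁺ p d) d ⟨
    (2 ^ quot⁺ p d) ^ d       ∎)

  2^n<2^1+n : ∀ n → 2 ^ n < 2 ^ suc n
  2^n<2^1+n n = ^-monoʳ-< 2 (s≤s (s≤s z≤n)) (n<1+n n)

  log-floor : ∀ n → 1 ≤ n → ∃ λ Λ → 2 ^ Λ ≤ n × n < 2 ^ suc Λ
  log-floor 1             _ = 0 , s≤s z≤n , s≤s (s≤s z≤n)
  log-floor (suc n@(suc _)) _ with log-floor n (s≤s z≤n)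
  ... | Λ , 2^Λ≤n , n<2^ with suc n <? 2 ^ suc Λ
  ...   | yes < = Λ , m≤n⇒m≤1+n 2^Λ≤n , <
  ...   | no ≮  = suc Λ , ≮⇒≥ ≮ , (begin-strict
    suc n                  ≤⟨ n<2^ ⟩
    2 ^ suc Λ              <⟨ 2^n<2^1+n (suc Λ) ⟩
    2 ^ suc (suc Λ)        ∎)

-- Bounds on OPT as powers of two

module ExponentBounds {n : ℕ} (G : Graph n) (conn : Connected G) where

  open import Data.Nat
  open import Data.Nat.Properties
  open import Data.Nat.Tactic.RingSolver using (solve-∀)
  open ≤-Reasoning
  open Graph G
  open Powers
  open Covering G conn

  complete⇒OPT≡0 : (∀ {a b} → ¬ NE G a b) → OPT G conn ≡ 0
  complete⇒OPT≡0 ¬ne = n≤0⇒n≡0 (OPT-≤ [] λ _ _ ne → contradiction ne ¬ne)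

  adjacent : ∀ {a b k} → a ≢ b → Walk G a b k → ∃ λ c → a ~ c
  adjacent a≢b []      = contradiction refl a≢b
  adjacent a≢b (e ∷ _) = _ , e

  -- Keeps log Δ within the domain of the logarithm and nonnegative.
  1≤maxDegree : 2 ≤ n → 1 ≤ maxDegree G
  1≤maxDegree 2≤n = ≤-trans (nonempty (∈-neighbours⁺ (proj₂ (adjacent a≢b (proj₂ (conn a b))))))
                            (length-neighbours a)
    where
    a b : Fin n
    a = fromℕ< (≤-trans (s≤s z≤n) 2≤n)
    b = fromℕ< 2≤n
    a≢b : a ≢ b
    a≢b a≡b with () ← trans (sym (toℕ-fromℕ< (≤-trans (s≤s z≤n) 2≤n))) (trans (cong toℕ a≡b) (toℕ-fromℕ< 2≤n))
    nonempty : ∀ {x xs} → x ∈ xs → 1 ≤ length {A = Fin n} xs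
    nonempty (here _)  = s≤s z≤n
    nonempty (there _) = s≤s z≤n

  -- The trivial bound n², sufficient when the approximate root exceeds 1.
  OPT≤2^ : ∀ {N} → n ≤ 2 ^ N → OPT G conn ≤ 2 ^ (2 * N)
  OPT≤2^ {N} n≤ = begin
    OPT G conn             ≤⟨ OPT≤n² ⟩
    n * n                  ≤⟨ *-mono-≤ n≤ n≤ ⟩
    2 ^ N * 2 ^ N          ≡⟨ ^-distribˡ-+-* 2 N N ⟨
    2 ^ (N + N)            ≡⟨ cong (λ z → 2 ^ (N + z)) (sym (+-identityʳ N)) ⟩
    2 ^ (2 * N)            ∎

  OPT≤2^-levels : ∀ {N Λ t k y₁ y₂} → n ≤ 2 ^ N → n < 2 ^ suc Λ → 1 ≤ Λ → Λ ≤ 2 ^ y₁ →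
                  maxDegree G ≤ 2 ^ y₂ → N ≤ t * k →
                  OPT G conn ≤ 2 ^ (N + t + (7 + 2 * (y₁ + y₂)) * suc k)
  OPT≤2^-levels {N} {Λ} {t} {k} {y₁} {y₂} n≤ n< 1≤Λ Λ≤ Δ≤ N≤ = begin
    OPT G conn
      ≤⟨ OPT-bound D (2 ^ t) h k {{D≢0}} {{m^n≢0 2 t}} D≥ n²< n≤r^k ⟩
    2 * D * 2 ^ t * (3 * (3 * h) * D) ^ k * n
      ≤⟨ *-mono-≤ (*-mono-≤ (*-monoˡ-≤ (2 ^ t) 2D≤) (^-monoˡ-≤ k c≤)) n≤ ⟩
    2 ^ Y * 2 ^ t * (2 ^ Y) ^ k * 2 ^ N
      ≡⟨ eq₀ (2 ^ Y) (2 ^ t) ((2 ^ Y) ^ k) (2 ^ N) ⟩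
    2 ^ N * 2 ^ t * (2 ^ Y) ^ suc k
      ≡⟨ cong₂ _*_ (sym (^-distribˡ-+-* 2 N t)) (^-*-assoc 2 Y (suc k)) ⟩
    2 ^ (N + t) * 2 ^ (Y * suc k)
      ≡⟨ ^-distribˡ-+-* 2 (N + t) (Y * suc k) ⟨
    2 ^ (N + t + Y * suc k) ∎
    where
    Δ = maxDegree G
    z = 2 ^ y₂
    w = 2 ^ y₁
    -- One exponent serves both `2 * D` and the growth factor per level, whence `suc k` copies of
    -- it; the 7 comes from 108 ≤ 2 ^ 7.
    Y = 7 + 2 * (y₁ + y₂)
    D = 3 * (z * z)
    h = 2 * suc Λ
    1≤z : 1 ≤ z
    1≤z = m^n>0 2 y₂
    1≤w : 1 ≤ w
    1≤w = m^n>0 2 y₁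
    D≢0 : NonZero D
    D≢0 = >-nonZero (*-mono-≤ {1} {3} (s≤s z≤n) (*-mono-≤ 1≤z 1≤z))
    D≥ : 1 + Δ + Δ * Δ ≤ D
    D≥ = begin
      1 + Δ + Δ * Δ              ≤⟨ +-mono-≤ (+-mono-≤ (*-mono-≤ 1≤z 1≤z) (≤-trans Δ≤ (m≤m*n z z {{>-nonZero 1≤z}}))) (*-mono-≤ Δ≤ Δ≤) ⟩
      z * z + z * z + z * z      ≡⟨ eq (z * z) ⟩
      D                          ∎
      where
      eq : ∀ x → x + x + x ≡ 3 * x
      eq = solve-∀
    n²< : n * n < 2 ^ h
    n²< = begin-strict
      n * n                      <⟨ *-mono-< n< n< ⟩
      2 ^ suc Λ * 2 ^ suc Λ      ≡⟨ ^-distribˡ-+-* 2 (suc Λ) (suc Λ) ⟨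
      2 ^ (suc Λ + suc Λ)        ≡⟨ cong (λ x → 2 ^ (suc Λ + x)) (sym (+-identityʳ (suc Λ))) ⟩
      2 ^ h                      ∎
    n≤r^k : n ≤ (2 ^ t) ^ k
    n≤r^k = begin
      n              ≤⟨ n≤ ⟩
      2 ^ N          ≤⟨ ^-monoʳ-≤ 2 N≤ ⟩
      2 ^ (t * k)    ≡⟨ ^-*-assoc 2 t k ⟨
      (2 ^ t) ^ k    ∎
    2^Y : 128 * (w * w * (z * z)) ≡ 2 ^ Y
    2^Y = trans (cong (128 *_) (trans (cong₂ _*_ (sym (^-distribˡ-+-* 2 y₁ y₁)) (sym (^-distribˡ-+-* 2 y₂ y₂)))
            (trans (sym (^-distribˡ-+-* 2 (y₁ + y₁) (y₂ + y₂))) (cong (2 ^_) (eq y₁ y₂)))))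
            (sym (^-distribˡ-+-* 2 7 (2 * (y₁ + y₂))))
      where
      eq : ∀ a b → a + a + (b + b) ≡ 2 * (a + b)
      eq = solve-∀
    2D≤ : 2 * D ≤ 2 ^ Y
    2D≤ = begin
      2 * (3 * (z * z))           ≡⟨ *-assoc 2 3 (z * z) ⟨
      6 * (z * z)                 ≤⟨ *-mono-≤ {6} {128} (m≤m+n 6 122) (m≤n*m (z * z) (w * w) {{>-nonZero (*-mono-≤ 1≤w 1≤w)}}) ⟩
      128 * (w * w * (z * z))     ≡⟨ 2^Y ⟩
      2 ^ Y                       ∎
    c≤ : 3 * (3 * h) * D ≤ 2 ^ Y
    c≤ = begin
      3 * (3 * (2 * suc Λ)) * D             ≤⟨ *-monoˡ-≤ D (*-monoʳ-≤ 3 (*-monoʳ-≤ 3 (*-monoʳ-≤ 2 (+-mono-≤ 1≤Λ (≤-refl {Λ}))))) ⟩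
      3 * (3 * (2 * (Λ + Λ))) * D           ≡⟨ eq₁ Λ (z * z) ⟩
      108 * (Λ * (z * z))                   ≤⟨ *-mono-≤ {108} {128} (m≤m+n 108 20) (*-monoˡ-≤ (z * z) (≤-trans Λ≤ (m≤m*n w w {{>-nonZero 1≤w}}))) ⟩
      128 * (w * w * (z * z))               ≡⟨ 2^Y ⟩
      2 ^ Y                                 ∎
      where
      eq₁ : ∀ l x → 3 * (3 * (2 * (l + l))) * (3 * x) ≡ 108 * (l * x)
      eq₁ = solve-∀
    eq₀ : ∀ a b c d → a * b * c * d ≡ d * b * (a * c)
    eq₀ = solve-∀

-- Connected graphs on fewer than three vertices are complete

module SmallGraphs where

  open import Data.Nat

  ¬NE-Fin2 : (G : Graph 2) (conn : Connected G) → ∀ {a b} → ¬ NE G a b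
  ¬NE-Fin2 G conn {a} {b} (a≢b , a≁b) = a≁b (first-step a≢b (proj₂ (conn a b)))
    where
    open Graph G
    two : ∀ {a b c : Fin 2} → a ≢ b → a ≢ c → b ≡ c
    two {zero}     {zero}     a≢b _   = contradiction refl a≢b
    two {zero}     {suc zero} {zero}     _ a≢c = contradiction refl a≢c
    two {zero}     {suc zero} {suc zero} _ _   = refl
    two {suc zero} {suc zero} a≢b _   = contradiction refl a≢b
    two {suc zero} {zero}     {suc zero} _ a≢c = contradiction refl a≢c
    two {suc zero} {zero}     {zero}     _ _   = refl
    first-step : ∀ {a b k} → a ≢ b → Walk G a b k → a ~ b
    first-step a≢b []      = contradiction refl a≢b
    first-step {a} a≢b (e ∷ _) = subst (a ~_) (two (λ where refl → ~-irr e) a≢b) e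

  <3⇒complete : ∀ {n} → n < 3 → (G : Graph n) (conn : Connected G) → ∀ {a b} → ¬ NE G a b
  <3⇒complete {0} _ G conn {()}
  <3⇒complete {1} _ G conn {zero} {zero} (a≢b , _) = a≢b refl
  <3⇒complete {2} _ G conn = ¬NE-Fin2 G conn
  <3⇒complete {suc (suc (suc _))} (s≤s (s≤s (s≤s ())))

-- The exponent estimate with cleared denominators

module ExponentArithmetic where

  open import Data.Nat
  open import Data.Nat.Properties
  open import Data.Nat.Tactic.RingSolver using (solve-∀)
  open ≤-Reasoning

  -- With c = P / R and e = ε / G, the bound reads M ≤ (1 + 81 e) c.

  exponent-large : ∀ {N} G R ε P → N * R ≤ P + R → R ≤ P → G ≤ ε →
                   suc (2 * N) * (G * R) ≤ (G + 81 * ε) * P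
  exponent-large {N} G R ε P NR≤ R≤P G≤ε = begin
    suc (2 * N) * (G * R)               ≡⟨ eq₁ N G R ⟩
    G * (R + 2 * (N * R))               ≤⟨ *-monoʳ-≤ G (+-mono-≤ R≤P (*-monoʳ-≤ 2 (≤-trans NR≤ (+-monoʳ-≤ P R≤P)))) ⟩
    G * (P + 2 * (P + P))               ≡⟨ eq₂ G P ⟩
    G * P + 4 * (G * P)                 ≤⟨ +-monoʳ-≤ (G * P) (*-mono-≤ {4} {81} (m≤m+n 4 77) (*-monoˡ-≤ P G≤ε)) ⟩
    G * P + 81 * (ε * P)                ≡⟨ eq₃ G ε P ⟩
    (G + 81 * ε) * P                    ∎
    where
    eq₁ : ∀ N G R → (1 + 2 * N) * (G * R) ≡ G * (R + 2 * (N * R))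
    eq₁ = solve-∀
    eq₂ : ∀ G P → G * (P + 2 * (P + P)) ≡ G * P + 4 * (G * P)
    eq₂ = solve-∀
    eq₃ : ∀ G ε P → G * P + 81 * (ε * P) ≡ (G + 81 * ε) * P
    eq₃ = solve-∀

  -- Here e ≤ 1, k is about 1 / e and t about N / k. The first two hypotheses read 1 ≤ 2e²c and y ≤
  -- 5e²c. Since k + 1 ≤ 3 / e, multiplying them by k + 1 leaves 6ec and 15ec; also N ≤ c + 2ec and
  -- t ≤ 5ec.
  exponent-small : ∀ {N t k y} G R ε P .{{_ : NonZero G}} .{{_ : NonZero k}} →
                   G * G * R ≤ 2 * (ε * ε * P) → y * (G * G * R) ≤ 5 * (ε * ε * P) →
                   N * R ≤ P + R → ε ≤ G → G ≤ k * ε → k * ε ≤ G + ε → t * k ≤ N + k →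
                   suc (N + t + (7 + 2 * y) * suc k) * (G * R) ≤ (G + 81 * ε) * P
  exponent-small {N} {t} {k} {y} G R ε P i ii NR≤ ε≤G G≤kε kε≤ tk≤ = begin
    suc (N + t + (7 + 2 * y) * suc k) * (G * R)
      ≡⟨ eq₀ N t y k (G * R) ⟩
    GR + N * GR + t * GR + 7 * (suc k * GR) + 2 * (y * suc k * GR)
      ≤⟨ +-mono-≤ (+-mono-≤ (+-mono-≤ (+-mono-≤ GR≤ NGR≤) tGR≤) (*-monoʳ-≤ 7 kGR≤)) (*-monoʳ-≤ 2 ykGR≤) ⟩
    -- The origin of the constant: 2 + 2 + 5 + 7 * 6 + 2 * 15 = 81.
    2 * (ε * P) + (G * P + 2 * (ε * P)) + 5 * (ε * P) + 7 * (6 * (ε * P)) + 2 * (15 * (ε * P))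
      ≡⟨ eq₁ G ε P ⟩
    (G + 81 * ε) * P ∎
    where
    GR = G * R
    eq₀ : ∀ N t y k g → (1 + (N + t + (7 + 2 * y) * (1 + k))) * g ≡
                        g + N * g + t * g + 7 * ((1 + k) * g) + 2 * (y * (1 + k) * g)
    eq₀ = solve-∀
    eq₁ : ∀ G ε P → 2 * (ε * P) + (G * P + 2 * (ε * P)) + 5 * (ε * P) + 7 * (6 * (ε * P)) + 2 * (15 * (ε * P))
                    ≡ (G + 81 * ε) * P
    eq₁ = solve-∀
    scaled : ∀ a b → a * (G * G * R) ≤ b * (ε * ε * P) → a * suc k * GR ≤ 3 * b * (ε * P)
    scaled a b a≤b = *-cancelˡ-≤ G (begin
      G * (a * suc k * (G * R))        ≡⟨ eq₂ G a k R ⟩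
      suc k * (a * (G * G * R))        ≤⟨ *-monoʳ-≤ (suc k) a≤b ⟩
      suc k * (b * (ε * ε * P))        ≡⟨ eq₃ k b ε P ⟩
      (ε + k * ε) * (b * (ε * P))      ≤⟨ *-monoˡ-≤ (b * (ε * P)) (≤-trans (+-mono-≤ ε≤G kε≤) (+-monoʳ-≤ G (+-monoʳ-≤ G ε≤G))) ⟩
      (G + (G + G)) * (b * (ε * P))    ≡⟨ eq₄ G b (ε * P) ⟩
      G * (3 * b * (ε * P))            ∎)
      where
      eq₂ : ∀ G a k R → G * (a * (1 + k) * (G * R)) ≡ (1 + k) * (a * (G * G * R))
      eq₂ = solve-∀
      eq₃ : ∀ k b ε P → (1 + k) * (b * (ε * ε * P)) ≡ (ε + k * ε) * (b * (ε * P))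
      eq₃ = solve-∀
      eq₄ : ∀ G b x → (G + (G + G)) * (b * x) ≡ G * (3 * b * x)
      eq₄ = solve-∀
    GR≤ : GR ≤ 2 * (ε * P)
    GR≤ = *-cancelˡ-≤ G (begin
      G * (G * R)             ≡⟨ *-assoc G G R ⟨
      G * G * R               ≤⟨ i ⟩
      2 * (ε * ε * P)         ≡⟨ eq₂ ε P ⟩
      ε * (2 * (ε * P))       ≤⟨ *-monoˡ-≤ (2 * (ε * P)) ε≤G ⟩
      G * (2 * (ε * P))       ∎)
      where
      eq₂ : ∀ ε P → 2 * (ε * ε * P) ≡ ε * (2 * (ε * P))
      eq₂ = solve-∀
    NGR≤ : N * GR ≤ G * P + 2 * (ε * P)
    NGR≤ = begin
      N * (G * R)             ≡⟨ eq₂ N G R ⟩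
      G * (N * R)             ≤⟨ *-monoʳ-≤ G NR≤ ⟩
      G * (P + R)             ≡⟨ *-distribˡ-+ G P R ⟩
      G * P + G * R           ≤⟨ +-monoʳ-≤ (G * P) GR≤ ⟩
      G * P + 2 * (ε * P)     ∎
      where
      eq₂ : ∀ N G R → N * (G * R) ≡ G * (N * R)
      eq₂ = solve-∀
    tG≤ : t * G ≤ N * ε + G
    tG≤ = *-cancelˡ-≤ k (begin
      k * (t * G)             ≡⟨ eq₂ k t G ⟩
      t * k * G               ≤⟨ *-monoˡ-≤ G tk≤ ⟩
      (N + k) * G             ≡⟨ *-distribʳ-+ G N k ⟩
      N * G + k * G           ≤⟨ +-monoˡ-≤ (k * G) (*-monoʳ-≤ N G≤kε) ⟩
      N * (k * ε) + k * G     ≡⟨ eq₃ N k ε G ⟩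
      k * (N * ε + G)         ∎)
      where
      eq₂ : ∀ k t G → k * (t * G) ≡ t * k * G
      eq₂ = solve-∀
      eq₃ : ∀ N k ε G → N * (k * ε) + k * G ≡ k * (N * ε + G)
      eq₃ = solve-∀
    tGR≤ : t * GR ≤ 5 * (ε * P)
    tGR≤ = begin
      t * (G * R)                              ≡⟨ *-assoc t G R ⟨
      t * G * R                                ≤⟨ *-monoˡ-≤ R tG≤ ⟩
      (N * ε + G) * R                          ≡⟨ eq₂ N ε G R ⟩
      ε * (N * R) + G * R                      ≤⟨ +-monoˡ-≤ (G * R) (*-monoʳ-≤ ε NR≤) ⟩
      ε * (P + R) + G * R                      ≡⟨ cong (_+ G * R) (*-distribˡ-+ ε P R) ⟩
      ε * P + ε * R + G * R                    ≤⟨ +-mono-≤ (+-monoʳ-≤ (ε * P) (≤-trans (*-monoˡ-≤ R ε≤G) GR≤)) GR≤ ⟩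
      ε * P + 2 * (ε * P) + 2 * (ε * P)        ≡⟨ eq₃ (ε * P) ⟩
      5 * (ε * P)                              ∎
      where
      eq₂ : ∀ N ε G R → (N * ε + G) * R ≡ ε * (N * R) + G * R
      eq₂ = solve-∀
      eq₃ : ∀ x → x + 2 * x + 2 * x ≡ 5 * x
      eq₃ = solve-∀
    kGR≤ : suc k * GR ≤ 6 * (ε * P)
    kGR≤ = subst (λ j → j * GR ≤ 6 * (ε * P)) (*-identityˡ (suc k))
             (scaled 1 2 (subst (_≤ 2 * (ε * ε * P)) (sym (*-identityˡ (G * G * R))) i))
    ykGR≤ : y * suc k * GR ≤ 15 * (ε * P)
    ykGR≤ = scaled y 5 ii

-- Rationals as quotients of naturals, and bounds on logarithms

module Fractions where

  open import Data.Integer.Base as ℤ using (ℤ; +_; -[1+_])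
  import Data.Integer.Properties as ℤ
  open import Data.Nat
  open import Data.Nat.Properties
  open import Data.Nat.Tactic.RingSolver using (solve-∀)
  open ≤-Reasoning
  open Powers

  infix 4 _is_over_

  -- Unnormalised rationals add and multiply componentwise, so numerators and denominators can be
  -- tracked exactly and comparisons become cross-multiplied inequalities in ℕ.
  record _is_over_ (q : ℚᵘ) (p d : ℕ) : Set where
    constructor is
    field
      numerator   : ↥ q ≡ + p
      denominator : ↧ₙ q ≡ d

  over≢0 : ∀ {q p d} → q is p over d → NonZero d
  over≢0 {mkℚᵘ _ _} (is _ refl) = _

  nat : ℕ → ℚᵘ
  nat m = mkℚᵘ (+ m) 0

  is-nat : ∀ m → nat m is m over 1
  is-nat m = is refl refl

  is-½ : ½ is 1 over 2
  is-½ = is refl refl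

  pos⇒fraction : ∀ {q} → 0ℚᵘ ℚ.< q → ∃₂ λ p d → q is p over d
  pos⇒fraction {mkℚᵘ (+ p) d} _ = p , suc d , is refl refl
  pos⇒fraction {mkℚᵘ -[1+ p ] d} (ℚ.*<* ())

  nat≤⇒fraction : ∀ {m q} → nat m ℚ.≤ q → ∃₂ λ p d → q is p over d
  nat≤⇒fraction {m} {mkℚᵘ (+ p) d} _ = p , suc d , is refl refl
  nat≤⇒fraction {m} {mkℚᵘ -[1+ p ] d} (ℚ.*≤* m≤) with () ← subst (ℤ._≤ _) (sym (ℤ.pos-* m (suc d))) m≤

  *-over : ∀ {q r p d p′ d′} → q is p over d → r is p′ over d′ → q ℚ.* r is p * p′ over d * d′
  *-over {mkℚᵘ _ _} {mkℚᵘ _ _} {p} {p′ = p′} (is refl refl) (is refl refl) = is (sym (ℤ.pos-* p p′)) refl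

  +-over : ∀ {q r p d p′ d′} → q is p over d → r is p′ over d′ → q ℚ.+ r is p * d′ + p′ * d over d * d′
  +-over {mkℚᵘ _ _} {mkℚᵘ _ _} {p} {d} {p′} {d′} (is refl refl) (is refl refl) =
    is (trans (cong₂ ℤ._+_ (sym (ℤ.pos-* p d′)) (sym (ℤ.pos-* p′ d))) (sym (ℤ.pos-+ (p * d′) (p′ * d)))) refl

  ^-over : ∀ {q p d} → q is p over d → ∀ k → q ^ℚ k is p ^ k over d ^ k
  ^-over q≐ zero    = is refl refl
  ^-over q≐ (suc k) = *-over q≐ (^-over q≐ k)

  ≤⇒over-≤ : ∀ {q r p d p′ d′} → q is p over d → r is p′ over d′ → q ℚ.≤ r → p * d′ ≤ p′ * d
  ≤⇒over-≤ {mkℚᵘ _ _} {mkℚᵘ _ _} {p} {d} {p′} {d′} (is refl refl) (is refl refl) (ℚ.*≤* q≤r)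
    rewrite sym (ℤ.pos-* p d′) | sym (ℤ.pos-* p′ d) = ℤ.drop‿+≤+ q≤r

  over-≤⇒≤ : ∀ {q r p d p′ d′} → q is p over d → r is p′ over d′ → p * d′ ≤ p′ * d → q ℚ.≤ r
  over-≤⇒≤ {mkℚᵘ _ _} {mkℚᵘ _ _} {p} {d} {p′} {d′} (is refl refl) (is refl refl) pd′≤p′d =
    ℚ.*≤* (subst (ℤ._≤ + p′ ℤ.* + d) (ℤ.pos-* p d′) (subst (+ (p * d′) ℤ.≤_) (ℤ.pos-* p′ d) (ℤ.+≤+ pd′≤p′d)))

  2^ℤ-over : ∀ k → 2^ℤ (+ k) is 2 ^ k over 1
  2^ℤ-over k = subst (2^ℤ (+ k) is 2 ^ k over_) (^-zeroˡ k) (^-over (is-nat 2) k)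

  -- Here 1 ≤ u / v ≤ a ≤ 2 ^ q, which rules out a negative q.
  ≤2^⇒^≤2^ : ∀ {a A B q} u v .{{_ : NonZero u}} .{{_ : NonZero v}} → v ≤ u →
             a is A over B → u * B ≤ A * v → a ≤ℚ2^ q →
             ∃ λ p → q is p over ↧ₙ q × u ^ ↧ₙ q ≤ 2 ^ p * v ^ ↧ₙ q
  ≤2^⇒^≤2^ {a} {A} {B} {q} u v v≤u a≐ uB≤ (inj₁ a≤0) = contradiction A≡0 (≢-nonZero⁻¹ A {{A≢0}})
    where
    instance
      B≢0 : NonZero B
      B≢0 = over≢0 a≐
    uB≢0 : NonZero (u * B)
    uB≢0 = m*n≢0 u B
    A≡0 : A ≡ 0
    A≡0 = n≤0⇒n≡0 (subst (_≤ 0) (*-identityʳ A) (≤⇒over-≤ a≐ (is-nat 0) a≤0))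
    A≢0 : NonZero A
    A≢0 = m*n≢0⇒m≢0 A {v} {{>-nonZero (<-≤-trans (>-nonZero⁻¹ (u * B) {{uB≢0}}) uB≤)}}
  ≤2^⇒^≤2^ {a} {A} {B} {mkℚᵘ (+ p) d′} u v v≤u a≐ uB≤ (inj₂ a^d≤) =
    p , (is refl refl) , *-cancelʳ-≤ (u ^ d) (2 ^ p * v ^ d) (B ^ d) {{m^n≢0 B d {{over≢0 a≐}}}} (begin
      u ^ d * B ^ d             ≡⟨ ^-distribʳ-* u B d ⟨
      (u * B) ^ d               ≤⟨ ^-monoˡ-≤ d uB≤ ⟩
      (A * v) ^ d               ≡⟨ ^-distribʳ-* A v d ⟩
      A ^ d * v ^ d             ≡⟨ cong (_* v ^ d) (*-identityʳ (A ^ d)) ⟨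
      A ^ d * 1 * v ^ d         ≤⟨ *-monoˡ-≤ (v ^ d) (≤⇒over-≤ (^-over a≐ d) (2^ℤ-over p) a^d≤) ⟩
      2 ^ p * B ^ d * v ^ d     ≡⟨ eq (2 ^ p) (B ^ d) (v ^ d) ⟩
      2 ^ p * v ^ d * B ^ d     ∎)
    where
    d = suc d′
    eq : ∀ x y z → x * y * z ≡ x * z * y
    eq = solve-∀
  ≤2^⇒^≤2^ {a} {A} {B} {mkℚᵘ -[1+ k ] d′} u v v≤u a≐ uB≤ (inj₂ a^d≤) =
    contradiction (*-cancelˡ-≤ ((u * B) ^ d) {{m^n≢0 (u * B) d {{uB≢0}}}} (begin
      (u * B) ^ d * 2 ^ suc k          ≤⟨ *-monoˡ-≤ (2 ^ suc k) (^-monoˡ-≤ d uB≤) ⟩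
      (A * v) ^ d * 2 ^ suc k          ≡⟨ cong (_* 2 ^ suc k) (^-distribʳ-* A v d) ⟩
      A ^ d * v ^ d * 2 ^ suc k        ≡⟨ eq (A ^ d) (v ^ d) (2 ^ suc k) ⟩
      A ^ d * 2 ^ suc k * v ^ d        ≤⟨ *-monoˡ-≤ (v ^ d) (≤⇒over-≤ (^-over a≐ d) (^-over is-½ (suc k)) a^d≤) ⟩
      1 ^ suc k * B ^ d * v ^ d        ≡⟨ cong (λ x → x * B ^ d * v ^ d) (^-zeroˡ (suc k)) ⟩
      1 * B ^ d * v ^ d                ≤⟨ *-monoʳ-≤ (1 * B ^ d) (^-monoˡ-≤ d v≤u) ⟩
      1 * B ^ d * u ^ d                ≡⟨ eq′ (B ^ d) (u ^ d) ⟩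
      u ^ d * B ^ d * 1                ≡⟨ cong (_* 1) (^-distribʳ-* u B d) ⟨
      (u * B) ^ d * 1                  ∎))
      (<⇒≱ (^-monoʳ-< 2 (s≤s (s≤s z≤n)) {0} {suc k} (s≤s z≤n)))
    where
    d = suc d′
    eq : ∀ x y z → x * y * z ≡ x * z * y
    eq = solve-∀
    instance
      B≢0 : NonZero B
      B≢0 = over≢0 a≐
    uB≢0 : NonZero (u * B)
    uB≢0 = m*n≢0 u B
    eq′ : ∀ x y → 1 * x * y ≡ y * x * 1
    eq′ = solve-∀

  2^≤⇒2^≤^ : ∀ {a A B q p d} m → a is A over B → A ≤ m * B → q is p over d → 2^ q ≤ℚ a → 2 ^ p ≤ m ^ d
  2^≤⇒2^≤^ {a} {A} {B} {mkℚᵘ _ d′} {p} m a≐ A≤ (is refl refl) (_ , 2^p≤) =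
    *-cancelʳ-≤ (2 ^ p) (m ^ d) (B ^ d) {{m^n≢0 B d {{over≢0 a≐}}}} (begin
      2 ^ p * B ^ d      ≤⟨ ≤⇒over-≤ (2^ℤ-over p) (^-over a≐ d) 2^p≤ ⟩
      A ^ d * 1          ≡⟨ *-identityʳ (A ^ d) ⟩
      A ^ d              ≤⟨ ^-monoˡ-≤ d A≤ ⟩
      (m * B) ^ d        ≡⟨ ^-distribʳ-* m B d ⟩
      m ^ d * B ^ d      ∎)
    where d = suc d′

  module LogBounds (n : ℕ) (3≤n : 3 ℕ.≤ n) where

    upper-log : ∀ m .{{_ : NonZero m}} {q} → upper (log (fromℕ m)) q → ∃ λ p → q is p over ↧ₙ q × m ^ ↧ₙ q ≤ 2 ^ p
    upper-log m {q} (a , m<a , a≤2^q) =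
      let A , B , a≐ = nat≤⇒fraction {m} {a} (ℚ.<⇒≤ m<a)
          p , q≐ , m^≤ = ≤2^⇒^≤2^ {q = q} m 1 (>-nonZero⁻¹ m) a≐ (≤⇒over-≤ (is-nat m) a≐ (ℚ.<⇒≤ m<a)) a≤2^q
      in p , q≐ , subst (m ^ ↧ₙ q ≤_) (trans (cong (2 ^ p *_) (^-zeroˡ (↧ₙ q))) (*-identityʳ (2 ^ p))) m^≤

    instance
      n≢0 : NonZero n
      n≢0 = >-nonZero (≤-trans (s≤s z≤n) 3≤n)

    -- The quotient under the root supplies a lower approximation `l` of log n, the power an upper
    -- one `c`. Through 2^l ≤ n ≤ 2^c, the latter can replace the former.
    lower≤upper : ∀ {c P R l p d} → c is P over R → n ^ R ≤ 2 ^ P → 0ℚᵘ ℚ.< l → l is p over d →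
                  lower (log (fromℕ n)) l → l ℚ.≤ c
    lower≤upper {c} {P} {R} {l} {p} {d} c≐ n^R≤ 0<l l≐ (a , a<n , 2^l≤a) =
      over-≤⇒≤ l≐ c≐ (^-cancelʳ-≤ 2 (s≤s (s≤s z≤n)) (begin
        2 ^ (p * R)      ≡⟨ ^-*-assoc 2 p R ⟨
        (2 ^ p) ^ R      ≤⟨ ^-monoˡ-≤ R 2^p≤n^d ⟩
        (n ^ d) ^ R      ≡⟨ ^-comm n d R ⟩
        (n ^ R) ^ d      ≤⟨ ^-monoˡ-≤ d n^R≤ ⟩
        (2 ^ P) ^ d      ≡⟨ ^-*-assoc 2 P d ⟩
        2 ^ (P * d)      ∎))
      where
      2^p≤n^d : 2 ^ p ≤ n ^ d
      2^p≤n^d =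
        let A , B , a≐ = pos⇒fraction (proj₁ 2^l≤a)
        in 2^≤⇒2^≤^ n a≐ (subst (_≤ n * B) (*-identityʳ A) (≤⇒over-≤ a≐ (is-nat n) (ℚ.<⇒≤ a<n))) l≐ 2^l≤a

    R≤P : ∀ {P R} → n ^ R ≤ 2 ^ P → R ≤ P
    R≤P {P} {R} n^R≤ = ^-cancelʳ-≤ 2 (s≤s (s≤s z≤n)) (≤-trans (^-monoˡ-≤ R (≤-trans (n≤1+n 2) 3≤n)) n^R≤)

    -- log n ≥ 3 / 2, from 8 < 9.
    3B≤2A : ∀ {A B} → n ^ B ≤ 2 ^ A → 3 * B ≤ A * 2
    3B≤2A {A} {B} n^B≤ = ^-cancelʳ-≤ 2 (s≤s (s≤s z≤n)) (begin
      2 ^ (3 * B)      ≡⟨ ^-*-assoc 2 3 B ⟨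
      8 ^ B            ≤⟨ ^-monoˡ-≤ B (n≤1+n 8) ⟩
      9 ^ B            ≡⟨ ^-comm 3 2 B ⟩
      (3 ^ B) ^ 2      ≤⟨ ^-monoˡ-≤ 2 (≤-trans (^-monoˡ-≤ B 3≤n) n^B≤) ⟩
      (2 ^ A) ^ 2      ≡⟨ ^-*-assoc 2 A 2 ⟩
      2 ^ (A * 2)      ∎)

    -- log (3 / 2) ≥ 1 / 2, again from 8 < 9.
    d≤2p : ∀ {p d} → 3 ^ d ≤ 2 ^ p * 2 ^ d → d ≤ 2 * p
    d≤2p {p} {d} 3^d≤ = ^-cancelʳ-≤ 2 (s≤s (s≤s z≤n)) (*-cancelˡ-≤ (4 ^ d) {{m^n≢0 4 d}} (begin
      4 ^ d * 2 ^ d                        ≡⟨ ^-distribʳ-* 4 2 d ⟨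
      8 ^ d                                ≤⟨ ^-monoˡ-≤ d (n≤1+n 8) ⟩
      9 ^ d                                ≡⟨ ^-comm 3 2 d ⟩
      (3 ^ d) ^ 2                          ≤⟨ ^-monoˡ-≤ 2 3^d≤ ⟩
      (2 ^ p * 2 ^ d) ^ 2                  ≡⟨ ^-distribʳ-* (2 ^ p) (2 ^ d) 2 ⟩
      (2 ^ p) ^ 2 * (2 ^ d) ^ 2            ≡⟨ cong₂ _*_ (trans (^-*-assoc 2 p 2) (cong (2 ^_) (*-comm p 2))) (^-comm 2 d 2) ⟩
      2 ^ (2 * p) * 4 ^ d                  ≡⟨ *-comm (2 ^ (2 * p)) (4 ^ d) ⟩
      4 ^ d * 2 ^ (2 * p)                  ∎))

    -- Two lower bounds on log n pass through the outer logarithm: the integer `Λ`, which controls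
    -- the number of halvings, and 3 / 2, which gives log log n ≥ 1 / 2.
    upper-loglog : ∀ {Λ} .{{_ : NonZero Λ}} → 2 ^ Λ ≤ n → ∀ {q} → upper (log (log (fromℕ n))) q →
                   ∃ λ p → q is p over ↧ₙ q × ↧ₙ q ≤ 2 * p × Λ ^ ↧ₙ q ≤ 2 ^ p
    upper-loglog {Λ} 2^Λ≤n {q} (a , n<2^a , a≤2^q) =
      let A , a≐ , n^B≤ = upper-log n {a} n<2^a
          B = ↧ₙ a
          ΛB≤A = ^-cancelʳ-≤ 2 (s≤s (s≤s z≤n)) (≤-trans (≤-reflexive (sym (^-*-assoc 2 Λ B))) (≤-trans (^-monoˡ-≤ B 2^Λ≤n) n^B≤))
          p , q≐ , Λ^≤ = ≤2^⇒^≤2^ {q = q} Λ 1 (>-nonZero⁻¹ Λ) a≐ (≤-trans ΛB≤A (≤-reflexive (sym (*-identityʳ A)))) a≤2^q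
          p′ , q≐′ , 3^≤ = ≤2^⇒^≤2^ {q = q} 3 2 (n≤1+n 2) a≐ (3B≤2A {A} {B} n^B≤) a≤2^q
          p′≡p = ℤ.+-injective (trans (sym (_is_over_.numerator q≐′)) (_is_over_.numerator q≐))
      in p , q≐ , d≤2p {p} (subst (λ x → 3 ^ ↧ₙ q ≤ 2 ^ x * 2 ^ ↧ₙ q) p′≡p 3^≤) ,
         subst (Λ ^ ↧ₙ q ≤_) (trans (cong (2 ^ p *_) (^-zeroˡ (↧ₙ q))) (*-identityʳ (2 ^ p))) Λ^≤

-- Choice of parameters and passage to real exponents

module Main {n : ℕ} (G : Graph n) (conn : Connected G) (3≤n : 3 ℕ.≤ n) where

  open import Data.Nat
  open import Data.Nat.Properties
  open import Data.Nat.Tactic.RingSolver using (solve-∀)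
  open ≤-Reasoning
  open Powers
  open Fractions
  open LogBounds n 3≤n
  open ExponentBounds G conn
  open ExponentArithmetic

  Δ : ℕ
  Δ = maxDegree G

  instance
    Δ≢0 : NonZero Δ
    Δ≢0 = >-nonZero (1≤maxDegree (≤-trans (n≤1+n 2) 3≤n))

  -- In the notation of the theorem, c, x₁, x₂ and l approximate log n, log log n,
  -- log Δ and log n, and e approximates the square root.
  exponent : ∀ {c P R e ε g x₁ x₂ l} → c is P over R → n ^ R ≤ 2 ^ P → e is ε over g → 0ℚᵘ ℚ.< e →
             0ℚᵘ ℚ.< l → lower (log (fromℕ n)) l → upper (log (log (fromℕ n))) x₁ → upper (log (fromℕ Δ)) x₂ →
             x₁ ℚ.+ x₂ ℚ.≤ e ℚ.* e ℚ.* l →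
             ∃ λ M → OPT G conn < 2 ^ M × M * (g * R) ≤ (g + 81 * ε) * P
  exponent {c} {P} {R} {e} {ε} {g} {x₁} {x₂} {l} c≐ n^R≤ e≐ 0<e 0<l l<log log<x₁ log<x₂ x≤ with ε ≤? g
  -- For e > 1 the trivial bound is enough. In both cases the `suc` makes the bound on OPT strict.
  ... | no ε≰g = suc (2 * N) , ≤-<-trans (OPT≤2^ {N} n≤2^N) (2^n<2^1+n (2 * N)) ,
                 exponent-large {N} g R ε P (quot⁺-lower P R) (R≤P n^R≤) (<⇒≤ (≰⇒> ε≰g))
    where
    instance
      R≢0 : NonZero R
      R≢0 = over≢0 c≐
    N = quot⁺ P R
    n≤2^N : n ≤ 2 ^ N
    n≤2^N = ≤2^quot⁺ n^R≤
  ... | yes ε≤g = suc M , ≤-<-trans OPT≤ (2^n<2^1+n M) ,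
                  exponent-small {N} {t} {k} {y₁ + y₂} g R ε P i ii (quot⁺-lower P R) ε≤g (quot⁺-upper g ε) (quot⁺-lower g ε) (quot⁺-lower N k)
    where
    instance
      R≢0 : NonZero R
      R≢0 = over≢0 c≐
      g≢0 : NonZero g
      g≢0 = over≢0 e≐
      ε≢0 : NonZero ε
      ε≢0 = ≢-nonZero λ ε≡0 → ℚ.<⇒≱ 0<e (over-≤⇒≤ e≐ (is-nat 0) (≤-reflexive (cong (_* 1) ε≡0)))
    Λ-found = log-floor n (>-nonZero⁻¹ n)
    Λ = proj₁ Λ-found
    n<2^ : n < 2 ^ suc Λ
    n<2^ = proj₂ (proj₂ Λ-found)
    1≤Λ : 1 ≤ Λ
    1≤Λ = s≤s⁻¹ (^-cancelʳ-≤ 2 {2} {suc Λ} (s≤s (s≤s z≤n)) (≤-trans (s≤s 3≤n) n<2^))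
    instance
      Λ≢0 : NonZero Λ
      Λ≢0 = >-nonZero 1≤Λ
    x₁-found = upper-loglog {Λ} (proj₁ (proj₂ Λ-found)) log<x₁
    x₂-found = upper-log Δ {x₂} log<x₂
    p₁ p₂ d₁ d₂ N k t y₁ y₂ M : ℕ
    p₁ = proj₁ x₁-found
    p₂ = proj₁ x₂-found
    d₁ = ↧ₙ x₁
    d₂ = ↧ₙ x₂
    x₁≐ : x₁ is p₁ over d₁
    x₁≐ = proj₁ (proj₂ x₁-found)
    x₂≐ : x₂ is p₂ over d₂
    x₂≐ = proj₁ (proj₂ x₂-found)
    instance
      d₁≢0 : NonZero d₁
      d₁≢0 = over≢0 x₁≐
      d₂≢0 : NonZero d₂
      d₂≢0 = over≢0 x₂≐
    d₁≤2p₁ : d₁ ≤ 2 * p₁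
    d₁≤2p₁ = proj₁ (proj₂ (proj₂ x₁-found))
    -- Rounded up: `N` is log n, `k` the number of levels 1 / e, 2 ^ t the shrinking factor `r`, and
    -- `y₁`, `y₂` are log log n and log Δ.
    N  = quot⁺ P R
    k  = quot⁺ g ε
    t  = quot⁺ N k
    y₁ = quot⁺ p₁ d₁
    y₂ = quot⁺ p₂ d₂
    M  = N + t + (7 + 2 * (y₁ + y₂)) * suc k
    OPT≤ : OPT G conn ≤ 2 ^ M
    OPT≤ = OPT≤2^-levels {N} {Λ} {t} {k} {y₁} {y₂} (≤2^quot⁺ n^R≤) n<2^ 1≤Λ (≤2^quot⁺ {Λ} {p₁} {d₁} (proj₂ (proj₂ (proj₂ x₁-found))))
             (≤2^quot⁺ {Δ} {p₂} {d₂} (proj₂ (proj₂ x₂-found))) (quot⁺-upper N k)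

    l-found = pos⇒fraction 0<l
    l≤c : l ℚ.≤ c
    l≤c = lower≤upper c≐ n^R≤ 0<l (proj₂ (proj₂ l-found)) l<log
    Z : ℕ
    Z = p₁ * d₂ + p₂ * d₁
    x≤e²c : Z * (g * g * R) ≤ ε * ε * P * (d₁ * d₂)
    x≤e²c = ≤⇒over-≤ (+-over x₁≐ x₂≐) (*-over (*-over e≐ e≐) c≐)
      (ℚ.≤-trans x≤ (ℚ.*-monoʳ-≤-nonNeg (e ℚ.* e) {{e²≥0}} l≤c))
      where
      e²≥0 : ℚ.NonNegative (e ℚ.* e)
      e²≥0 = ℚ.nonNegative (over-≤⇒≤ (is-nat 0) (*-over e≐ e≐) z≤n)
    -- `Z / (d₁ * d₂)` is x₁ + x₂, which is at most e²c; so b times it bounds anything by b e²c.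
    from-Z : ∀ a b → a * (d₁ * d₂) ≤ b * Z → a * (g * g * R) ≤ b * (ε * ε * P)
    from-Z a b a≤bZ = *-cancelʳ-≤ _ _ (d₁ * d₂) {{m*n≢0 d₁ d₂}} (begin
      a * (g * g * R) * (d₁ * d₂)      ≡⟨ eq₁ a (g * g * R) (d₁ * d₂) ⟩
      a * (d₁ * d₂) * (g * g * R)      ≤⟨ *-monoˡ-≤ (g * g * R) a≤bZ ⟩
      b * Z * (g * g * R)              ≡⟨ *-assoc b Z (g * g * R) ⟩
      b * (Z * (g * g * R))            ≤⟨ *-monoʳ-≤ b x≤e²c ⟩
      b * (ε * ε * P * (d₁ * d₂))      ≡⟨ *-assoc b (ε * ε * P) (d₁ * d₂) ⟨
      b * (ε * ε * P) * (d₁ * d₂)      ∎)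
      where
      eq₁ : ∀ a x y → a * x * y ≡ a * y * x
      eq₁ = solve-∀
    i : g * g * R ≤ 2 * (ε * ε * P)
    i = subst (_≤ 2 * (ε * ε * P)) (*-identityˡ (g * g * R)) (from-Z 1 2 (begin
      1 * (d₁ * d₂)      ≡⟨ *-identityˡ (d₁ * d₂) ⟩
      d₁ * d₂            ≤⟨ *-monoˡ-≤ d₂ d₁≤2p₁ ⟩
      2 * p₁ * d₂        ≡⟨ *-assoc 2 p₁ d₂ ⟩
      2 * (p₁ * d₂)      ≤⟨ *-monoʳ-≤ 2 (m≤m+n (p₁ * d₂) (p₂ * d₁)) ⟩
      2 * Z              ∎))
    -- Rounding adds at most 2 to x₁ + x₂, and 2 ≤ 4x₁ because x₁ ≥ 1 / 2; hence the 5.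
    ii : (y₁ + y₂) * (g * g * R) ≤ 5 * (ε * ε * P)
    ii = from-Z (y₁ + y₂) 5 (begin
      (y₁ + y₂) * (d₁ * d₂)
        ≡⟨ eq₁ y₁ y₂ d₁ d₂ ⟩
      y₁ * d₁ * d₂ + y₂ * d₂ * d₁
        ≤⟨ +-mono-≤ (*-monoˡ-≤ d₂ (quot⁺-lower p₁ d₁)) (*-monoˡ-≤ d₁ (quot⁺-lower p₂ d₂)) ⟩
      (p₁ + d₁) * d₂ + (p₂ + d₂) * d₁
        ≡⟨ eq₂ p₁ p₂ d₁ d₂ ⟩
      Z + 2 * (d₁ * d₂)
        ≤⟨ +-monoʳ-≤ Z (*-monoʳ-≤ 2 (*-monoˡ-≤ d₂ d₁≤2p₁)) ⟩
      Z + 2 * (2 * p₁ * d₂)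
        ≤⟨ m≤m+n _ (4 * (p₂ * d₁)) ⟩
      Z + 2 * (2 * p₁ * d₂) + 4 * (p₂ * d₁)
        ≡⟨ eq₃ p₁ p₂ d₁ d₂ ⟩
      5 * Z ∎)
      where
      eq₁ : ∀ a b c d → (a + b) * (c * d) ≡ a * c * d + b * d * c
      eq₁ = solve-∀
      eq₂ : ∀ p q c d → (p + c) * d + (q + d) * c ≡ p * d + q * c + 2 * (c * d)
      eq₂ = solve-∀
      eq₃ : ∀ p q c d → p * d + q * c + 2 * (2 * p * d) + 4 * (q * c) ≡ 5 * (p * d + q * c)
      eq₃ = solve-∀

  -- Otherwise 2^M ≤ 2^a ≤ q ≤ OPT. The strict hypothesis yields the strict inequality that the
  -- upper cut of a natural number demands.
  OPT<2^⇒OPT< : ∀ {M a q} → OPT G conn < 2 ^ M → nat M ℚ.≤ a → 2^ a ≤ℚ q → nat (OPT G conn) ℚ.< q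
  OPT<2^⇒OPT< {M} {a} {q} OPT< M≤a 2^a≤q = ℚ.≰⇒> λ q≤OPT →
    let p , d , a≐ = nat≤⇒fraction {M} {a} M≤a
        A , B , q≐ = pos⇒fraction (proj₁ 2^a≤q)
        A≤ = subst (_≤ OPT G conn * B) (*-identityʳ A) (≤⇒over-≤ q≐ (is-nat (OPT G conn)) q≤OPT)
        Md≤p = subst (M * d ≤_) (*-identityʳ p) (≤⇒over-≤ (is-nat M) a≐ M≤a)
    in <⇒≱ (^-monoˡ-< d {{over≢0 a≐}} OPT<) (begin
      (2 ^ M) ^ d          ≡⟨ ^-*-assoc 2 M d ⟩
      2 ^ (M * d)          ≤⟨ ^-monoʳ-≤ 2 Md≤p ⟩
      2 ^ p                ≤⟨ 2^≤⇒2^≤^ (OPT G conn) q≐ A≤ a≐ 2^a≤q ⟩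
      OPT G conn ^ d       ∎)

  -- Reassembles the exponent from the approximations of its parts: M ≤ (1 + 81e)c ≤ (b₁ + b₂)c ≤ bc
  -- ≤ a.
  nat≤[1+81e]c : ∀ {M c P R e ε g a b b₁ b₂ C₁} → c is P over R → e is ε over g →
                 M * (g * R) ≤ (g + 81 * ε) * P →
                 nat 1 ℚ.< b₁ → nat 81 ℚ.< C₁ → C₁ ℚ.* e ℚ.≤ b₂ → b₁ ℚ.+ b₂ ℚ.≤ b → b ℚ.* c ℚ.≤ a → nat M ℚ.≤ a
  nat≤[1+81e]c {M} {c} {P} {R} {e} {ε} {g} c≐ e≐ M≤ 1<b₁ 81<C₁ C₁e≤b₂ b₁+b₂≤b bc≤a =
    ℚ.≤-trans (over-≤⇒≤ (is-nat M) (*-over (+-over (is-nat 1) (*-over (is-nat 81) e≐)) c≐) M≤′)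
      (ℚ.≤-trans (ℚ.*-monoˡ-≤-nonNeg c {{nonNeg c≐}}
        (ℚ.≤-trans (ℚ.+-mono-≤ (ℚ.<⇒≤ 1<b₁)
          (ℚ.≤-trans (ℚ.*-monoˡ-≤-nonNeg e {{nonNeg e≐}} (ℚ.<⇒≤ 81<C₁)) C₁e≤b₂)) b₁+b₂≤b)) bc≤a)
    where
    nonNeg : ∀ {q p d} → q is p over d → ℚ.NonNegative q
    nonNeg q≐ = ℚ.nonNegative (over-≤⇒≤ (is-nat 0) q≐ z≤n)
    M≤′ : M * (1 * (1 * g) * R) ≤ (1 * (1 * g) + 81 * ε * 1) * P * 1
    M≤′ = begin
      M * (1 * (1 * g) * R)                      ≡⟨ eq₁ M g R ⟩
      M * (g * R)                                ≤⟨ M≤ ⟩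
      (g + 81 * ε) * P                           ≡⟨ eq₂ g ε P ⟩
      (1 * (1 * g) + 81 * ε * 1) * P * 1         ∎
      where
      eq₁ : ∀ M g R → M * (1 * (1 * g) * R) ≡ M * (g * R)
      eq₁ = solve-∀
      eq₂ : ∀ g ε P → (g + 81 * ε) * P ≡ (1 * (1 * g) + 81 * ε * 1) * P * 1
      eq₂ = solve-∀

open import Defs

theorem6 : ∃ λ (C : ℕ) → ∀ {n : ℕ} (G : Graph n) (conn : Connected G) →
    fromℕ (OPT G conn) ≤
    fromℕ n ^ (fromℕ 1 + fromℕ C * √ ((log (log (fromℕ n)) + log (fromℕ (maxDegree G))) / log (fromℕ n)))
theorem6 = 81 , bound
  where
  bound : ∀ {n : ℕ} (G : Graph n) (conn : Connected G) →
    fromℕ (OPT G conn) ≤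
    fromℕ n ^ (fromℕ 1 + fromℕ 81 * √ ((log (log (fromℕ n)) + log (fromℕ (maxDegree G))) / log (fromℕ n)))
  bound {n} G conn q q∈ with 3 ℕ.≤? n
  -- With OPT = 0 only 0 < q remains, and every member of the upper cut of `exp₂` is positive,
  -- whatever its argument.
  bound {n} G conn q q∈ | no 3≰n
    rewrite ExponentBounds.complete⇒OPT≡0 G conn (λ {a} {b} → SmallGraphs.<3⇒complete (ℕ.≰⇒> 3≰n) G conn {a} {b}) = proj₁ (proj₂ (proj₂ q∈))
  -- The cut unfolds into `c` above log n, `e` above the root, `l` below log n, and `x₁`, `x₂` above
  -- log log n and log Δ, with x₁ + x₂ ≤ e²l.
  bound {n} G conn q
    (a , (b , c , _ , (b₁ , b₂ , 1<b₁ , (C₁ , e , _ , 81<C₁ , _ ,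
      (0<e , x , l , _ , (x₁ , x₂ , log<x₁ , log<x₂ , x₁+x₂≤x) , 0<l , l<log , x≤e²l) , C₁e≤b₂) , b₁+b₂≤b) ,
      _ , log<c , bc≤a) , 2^a≤q) | yes 3≤n =
    let P , c≐ , n^R≤ = upper-log n {c} log<c
        _ , _ , e≐ = pos⇒fraction {e} 0<e
        M , OPT<2^M , M≤ = exponent {c} {e = e} {x₁ = x₁} {x₂} {l} c≐ n^R≤ e≐ 0<e 0<l l<log log<x₁ log<x₂
                             (ℚ.≤-trans x₁+x₂≤x x≤e²l)
    in OPT<2^⇒OPT< {M} {a} {q} OPT<2^M
         (nat≤[1+81e]c {M} {c} {e = e} {b = b} {C₁ = C₁} c≐ e≐ M≤ 1<b₁ 81<C₁ C₁e≤b₂ b₁+b₂≤b bc≤a) 2^a≤q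
    where
    open Fractions
    open Main G conn 3≤n
    open LogBounds n 3≤n
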